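{- Let $n\ge 1$ and let $\mathcal C\subset M_n(\mathbb{F}_2)$ be an additively closed set of $n\times n$ matrices over $\mathbb{F}_2$ (identified with $\mathbb{F}_2$-linear maps $\mathbb{F}_2^n\to\mathbb{F}_2^n$) such that $|\mathcal C|=2^{2n}$ and $\mathrm{rank}(A)\ge n-1$ for all $0\ne A\in\mathcal C$. Then there exist two presemifields $(\mathbb{F}_2^n,\star)$ and $(\mathbb{F}_2^n,\circ)$ such that \[ \mathcal C=\{x\mapsto a\star x-b\circ x \;:\; a,b\in\mathbb{F}_2^n\}. \] In particular, $\mathcal C$ contains an additively closed set $\mathcal C'$ with $|\mathcal C'|=2^n$ all of whose nonzero elements are invertible.
   Context: A presemifield $(\mathbb{F}_q^n,\circ)$ is the vector space $\mathbb{F}_q^n$ equipped with a multiplication $\circ$ that is biadditive (distributive on both sides, not necessarily associative, no identity required) and has no zero divisors: $x\circ y=0$ implies $x=0$ or $y=0$. Equivalently, it is a finite-dimensional (not necessarily associative) division algebra over a finite field. For a presemifield, the set $\{x\mapsto x\circ y: y\in\mathbb{F}_q^n\}$ is an additive set of $q^n$ matrices in $M_n(\mathbb{F}_q)$ all of whose nonzero elements are invertible (a semifield spread set). In the terminology of rank-metric codes, $\mathcal C$ in the claim is an additive maximum rank distance (MRD) code with minimum distance $n-1$. -}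

module Defs where

open import Algebra.Bundles using (CommutativeRing)
open import Algebra.Core using (Op₂)
open import Data.Bool.Base using (Bool)
open import Data.Bool.Properties using (xor-∧-commutativeRing)
open import Data.Fin.Base using (Fin)
open import Data.Nat.Base using (ℕ; _≤_)
open import Data.Product.Base using (Σ-syntax; ∃-syntax; _×_)
open import Data.Sum.Base using (_⊎_)
open import Data.Vec.Base using (Vec; []; _∷_; map; zipWith; replicate; foldr; transpose)
open import Function.Bundles using (_⇔_)
open import Function.Definitions using (Injective)
open import Level using (0ℓ)
open import Relation.Binary.PropositionalEquality using (_≡_)
open import Relation.Unary using (Pred; _∈_)

import Algebra.Definitions as AlgebraDefinitions

-- 𝔽₂ is Bool, with xor as addition and ∧ as multiplication.
F₂ : Set
F₂ = Bool

open CommutativeRing xor-∧-commutativeRing public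
  using () renaming (_+_ to _+₂_; _*_ to _*₂_; _-_ to _-₂_; 0# to 0₂; 1# to 1₂)

F₂^ : ℕ → Set
F₂^ n = Vec F₂ n

infixl 6 _+ᵥ_ _-ᵥ_ _+ₘ_
infixl 7 _·ᵥ_ _*ᵥ_ _*ₘ_

0ᵥ : ∀ {n} → F₂^ n
0ᵥ = replicate _ 0₂

_+ᵥ_ : ∀ {n} → Op₂ (F₂^ n)
_+ᵥ_ = zipWith _+₂_

_-ᵥ_ : ∀ {n} → Op₂ (F₂^ n)
_-ᵥ_ = zipWith _-₂_

_·ᵥ_ : ∀ {n} → F₂ → F₂^ n → F₂^ n
c ·ᵥ v = map (c *₂_) v

-- Square matrices, stored as vectors of rows.
M : ℕ → Set
M n = Vec (F₂^ n) n

0ₘ : ∀ {n} → M n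
0ₘ = replicate _ 0ᵥ

1ₘ : ∀ {n} → M n
1ₘ {n} = identity n
  where
  identity : ∀ k → M k
  identity ℕ.zero    = []
  identity (ℕ.suc k) = (1₂ ∷ 0ᵥ) ∷ map (0₂ ∷_) (identity k)

_+ₘ_ : ∀ {n} → Op₂ (M n)
_+ₘ_ = zipWith _+ᵥ_

dot : ∀ {n} → F₂^ n → F₂^ n → F₂
dot u v = foldr _ _+₂_ 0₂ (zipWith _*₂_ u v)

_*ᵥ_ : ∀ {n} → M n → F₂^ n → F₂^ n
A *ᵥ x = map (λ row → dot row x) A

_*ₘ_ : ∀ {n} → Op₂ (M n)
A *ₘ B = map (λ row → map (dot row) (transpose B)) A

Invertible : ∀ {n} → M n → Set
Invertible {n} A = ∃[ B ] (A *ₘ B ≡ 1ₘ × B *ₘ A ≡ 1ₘ)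

linearCombination : ∀ {n r} → Vec F₂ r → Vec (F₂^ n) r → F₂^ n
linearCombination cs vs = foldr _ _+ᵥ_ 0ᵥ (zipWith _·ᵥ_ cs vs)

LinearlyIndependent : ∀ {n r} → Vec (F₂^ n) r → Set
LinearlyIndependent vs = ∀ cs → linearCombination cs vs ≡ 0ᵥ → cs ≡ 0ᵥ

Span : ∀ {n r} → Vec (F₂^ n) r → Pred (F₂^ n) 0ℓ
Span vs v = ∃[ cs ] linearCombination cs vs ≡ v

HasDimension : ∀ {n} → Pred (F₂^ n) 0ℓ → ℕ → Set
HasDimension {n} U r =
  Σ[ vs ∈ Vec (F₂^ n) r ] (LinearlyIndependent vs × (∀ v → v ∈ U ⇔ v ∈ Span vs))

Image : ∀ {n} → M n → Pred (F₂^ n) 0ℓ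
Image A v = ∃[ x ] A *ᵥ x ≡ v

HasRank : ∀ {n} → M n → ℕ → Set
HasRank A r = HasDimension (Image A) r

rank[_]≥_ : ∀ {n} → M n → ℕ → Set
rank[ A ]≥ k = ∃[ r ] (HasRank A r × k ≤ r)

AdditivelyClosed : ∀ {n} → Pred (M n) 0ℓ → Set
AdditivelyClosed C = ∀ A B → A ∈ C → B ∈ C → A +ₘ B ∈ C

-- The elements of C are listed without repetition by Fin k.  (A bijection with
-- Σ A (A ∈ C) would instead also count the proofs of membership.)
HasCardinality : {X : Set} → Pred X 0ℓ → ℕ → Set
HasCardinality {X} C k =
  Σ[ f ∈ (Fin k → X) ] (Injective _≡_ _≡_ f × (∀ A → A ∈ C ⇔ (∃[ i ] f i ≡ A)))

record IsPresemifield {n : ℕ} (_∘_ : Op₂ (F₂^ n)) : Set where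
  open AlgebraDefinitions {A = F₂^ n} _≡_ using (_DistributesOver_)
  field
    distrib         : _∘_ DistributesOver _+ᵥ_
    noZeroDivisors  : ∀ x y → x ∘ y ≡ 0ᵥ → x ≡ 0ᵥ ⊎ y ≡ 0ᵥ

-- The matrices in C, regarded as maps; maps are compared pointwise.
Maps : ∀ {n} → Pred (M n) 0ℓ → Pred (F₂^ n → F₂^ n) 0ℓ
Maps C f = ∃[ A ] (A ∈ C × (∀ x → A *ᵥ x ≡ f x))

DifferenceMaps : ∀ {n} → Op₂ (F₂^ n) → Op₂ (F₂^ n) → Pred (F₂^ n → F₂^ n) 0ℓ
DifferenceMaps _⋆_ _∘_ f = ∃[ a ] ∃[ b ] (∀ x → f x ≡ (a ⋆ x) -ᵥ (b ∘ x))

{-# OPTIONS --safe #-}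

-- For distinct nonzero x and y, A ↦ (A x , A y) is injective on C, hence bijective onto pairs of
-- vectors.  Counting with it, for x, v ≠ 0 exactly two nonsingular elements of C send x to v, and
-- every nonzero singular element of C is the sum of exactly one unordered pair of nonsingular
-- ones.  The latter makes the relation "h + k is zero or nonsingular" transitive on the
-- nonsingular elements.  Each of its classes, together with 0, is a subspace on which evaluation
-- at a fixed x ≠ 0 is bijective, so there are two classes, and C is the direct sum of these two
-- subspaces, which are the spread sets of ⋆ and ∘.
module Submission where

open import Defs
open import Algebra.Bundles using (CommutativeRing)
open import Algebra.Core using (Op₂)
open import Algebra.Definitions using (Associative; Commutative; LeftIdentity)
open import Data.Bool.Base using (Bool; true; false)
open import Data.Bool.Properties using (xor-∧-commutativeRing; xor-same) renaming (_≟_ to _≟ᵇ_)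
open import Data.Empty using (⊥; ⊥-elim)
open import Data.Fin.Base using (Fin; zero; suc; combine; remQuot; punchOut)
open import Data.Fin.Properties using (_≟_; any?; injective⇒≤; 2↔Bool; punchOut-injective; combine-remQuot; remQuot-combine)
open import Data.Nat.Base using (ℕ; zero; suc; _≤_; _*_; _^_; _∸_; z≤n; s≤s)
open import Data.Nat.Properties using (^-monoʳ-<; ≤⇒≯; 1+n≰n; ≰⇒>; _≤?_; ≤-trans)
open import Data.Product.Base using (Σ-syntax; ∃-syntax; ∃; _×_; _,_; proj₁; proj₂)
open import Data.Sum.Base using (_⊎_; inj₁; inj₂)
open import Data.Vec.Base using (Vec; []; _∷_; _++_; head; map; zipWith; replicate; lookup; tabulate; transpose; _⊛_)
open import Data.Vec.Properties using (≡-dec; zipWith-assoc; zipWith-comm; zipWith-identityˡ; ∷-injective; ++-injective; lookup-map; lookup∘tabulate; tabulate∘lookup; tabulate-cong; lookup-zipWith)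
open import Function.Base using (_∘_)
open import Function.Bundles using (Equivalence; Inverse; mk⇔)
open import Function.Definitions using (Injective)
open import Level using (0ℓ)
open import Relation.Binary.Definitions using (DecidableEquality)
open import Relation.Binary.PropositionalEquality using (_≡_; _≢_; refl; sym; trans; cong; cong₂; subst; module ≡-Reasoning)
open import Relation.Nullary.Decidable using (Dec; yes; no; ¬?; _×-dec_; map′)
open import Relation.Nullary.Negation using (¬_; contradiction)
open import Relation.Unary using (Pred; Decidable; _∈_; _⊆_; _≐_)

-- The number two is where the field enters. Distinct nonzero vectors over 𝔽₂ are independent, so
-- among the 2ⁿ elements of the code sending `x` to `v` each of the 2ⁿ - 2 vectors other than `0`
-- and `x` rules out a different one. Over a larger field one element goes per line only, more than
-- two survive, and the sum of "the other two" no longer makes sense. The counts are phrased as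
-- self-maps of a finite set, for which injective and surjective coincide. Hence the zero vector and
-- other excluded arguments receive default values, and an index together with a vector is stored as
-- one bit vector of length n + 1.

private
  module F = CommutativeRing xor-∧-commutativeRing

-- Finite sets of bit vectors

encode : ∀ {m} → F₂^ m → Fin (2 ^ m)
encode []      = zero
encode (b ∷ v) = combine (Inverse.from 2↔Bool b) (encode v)

decode : ∀ m → Fin (2 ^ m) → F₂^ m
decode zero    _ = []
decode (suc m) i = Inverse.to 2↔Bool (proj₁ (remQuot {2} (2 ^ m) i)) ∷ decode m (proj₂ (remQuot {2} (2 ^ m) i))

decode-encode : ∀ {m} (v : F₂^ m) → decode m (encode v) ≡ v
decode-encode         []      = refl
decode-encode {suc m} (b ∷ v)
  = cong₂ _∷_
      (trans (cong (Inverse.to 2↔Bool ∘ proj₁) digits) (Inverse.strictlyInverseˡ 2↔Bool b))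
      (trans (cong (decode m ∘ proj₂) digits) (decode-encode v))
  where
  digits : remQuot {2} (2 ^ m) (combine (Inverse.from 2↔Bool b) (encode v)) ≡ (Inverse.from 2↔Bool b , encode v)
  digits = remQuot-combine {2} (Inverse.from 2↔Bool b) (encode v)

encode-decode : ∀ m (i : Fin (2 ^ m)) → encode (decode m i) ≡ i
encode-decode zero    zero = refl
encode-decode (suc m) i    = trans
  (cong₂ combine (Inverse.strictlyInverseʳ 2↔Bool (proj₁ (remQuot {2} (2 ^ m) i))) (encode-decode m _))
  (combine-remQuot {2} (2 ^ m) i)

encode-injective : ∀ {m} → Injective _≡_ _≡_ (encode {m})
encode-injective {m} {u} {v} eq =
  trans (sym (decode-encode u)) (trans (cong (decode m) eq) (decode-encode v))

decode-injective : ∀ m → Injective _≡_ _≡_ (decode m)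
decode-injective m {i} {j} eq =
  trans (sym (encode-decode m i)) (trans (cong encode eq) (encode-decode m j))

Fin-injective⇒surjective : ∀ {k} {f : Fin k → Fin k} → Injective _≡_ _≡_ f → ∀ j → ∃[ i ] f i ≡ j
Fin-injective⇒surjective {suc k} {f} inj j with any? (λ i → f i ≟ j)
... | yes found = found
... | no  missed = contradiction (injective⇒≤ avoid-injective) 1+n≰n
  where
  avoid : Fin (suc k) → Fin k
  avoid i = punchOut {i = j} {j = f i} (λ eq → missed (i , sym eq))
  avoid-injective : Injective _≡_ _≡_ avoid
  avoid-injective {x} {y} eq = inj (punchOut-injective {i = j}
    (λ e → missed (x , sym e)) (λ e → missed (y , sym e)) eq)

_≟ᵥ_ : ∀ {m} → DecidableEquality (F₂^ m)
_≟ᵥ_ = ≡-dec _≟ᵇ_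

_≟ₘ_ : ∀ {n} → DecidableEquality (M n)
_≟ₘ_ = ≡-dec _≟ᵥ_

exists? : ∀ {m} {P : Pred (F₂^ m) 0ℓ} → Decidable P → Dec (∃ P)
exists? {m} {P} P? = map′ (λ (i , p) → decode m i , p)
                          (λ (v , p) → encode v , subst P (sym (decode-encode v)) p)
                          (any? (P? ∘ decode m))

injective⇒surjective : ∀ {m} {f : F₂^ m → F₂^ m} → Injective _≡_ _≡_ f → ∀ v → ∃[ u ] f u ≡ v
injective⇒surjective {m} {f} inj v =
  let i , eq = Fin-injective⇒surjective {f = encode ∘ f ∘ decode m}
                 (decode-injective m ∘ inj ∘ encode-injective) (encode v)
  in decode m i , encode-injective eq

-- A section of `f` is injective, hence onto, so every vector is a chosen preimage and `f` is
-- inverted by the section.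
surjective⇒injective : ∀ {m} {f : F₂^ m → F₂^ m} → (∀ v → ∃[ u ] f u ≡ v) → Injective _≡_ _≡_ f
surjective⇒injective {m} {f} surj {x} {y} fx≡fy =
  trans (sym (section-retract x)) (trans (cong section fx≡fy) (section-retract y))
  where
  section : F₂^ m → F₂^ m
  section v = proj₁ (surj v)
  section-injective : Injective _≡_ _≡_ section
  section-injective {u} {v} eq = trans (sym (proj₂ (surj u))) (trans (cong f eq) (proj₂ (surj v)))
  section-retract : ∀ u → section (f u) ≡ u
  section-retract u with injective⇒surjective section-injective u
  ... | v , refl = cong section (proj₂ (surj v))

injective⇒dim≤ : ∀ {m k} {f : F₂^ m → F₂^ k} → Injective _≡_ _≡_ f → m ≤ k
injective⇒dim≤ {m} {k} {f} inj with m ≤? k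
... | yes m≤k = m≤k
... | no  m≰k = contradiction (^-monoʳ-< 2 (s≤s (s≤s z≤n)) (≰⇒> m≰k))
  (≤⇒≯ (injective⇒≤ {f = encode ∘ f ∘ decode m} (decode-injective m ∘ inj ∘ encode-injective)))

-- If every value were attained on `D`, choosing preimages in `D` would be an injective self-map,
-- hence onto, and would reach `a` outside `D`.
injective-on⇒missed : ∀ {m} {D : Pred (F₂^ m) 0ℓ} {f : F₂^ m → F₂^ m} → Decidable D →
  (∀ {u v} → D u → D v → f u ≡ f v → u ≡ v) → (∃[ a ] ¬ D a) → ∃[ c ] (∀ w → D w → f w ≢ c)
injective-on⇒missed {m} {D} {f} D? inj (a , ¬Da)
  with exists? (λ c → ¬? (exists? (λ w → D? w ×-dec (f w ≟ᵥ c))))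
... | yes (c , missed) = c , λ w Dw eq → missed (w , Dw , eq)
... | no  none-missed = ⊥-elim (¬Da (subst D (proj₂ hit-a) (proj₁ (proj₂ (preimage (proj₁ hit-a))))))
  where
  preimage : ∀ c → ∃[ w ] (D w × f w ≡ c)
  preimage c with exists? (λ w → D? w ×-dec (f w ≟ᵥ c))
  ... | yes found = found
  ... | no  missed = ⊥-elim (none-missed (c , missed))
  hit-a : ∃[ c ] proj₁ (preimage c) ≡ a
  hit-a = injective⇒surjective
    (λ {c} {d} eq → trans (sym (proj₂ (proj₂ (preimage c)))) (trans (cong f eq) (proj₂ (proj₂ (preimage d))))) a

update : ∀ {m} → F₂^ m → F₂^ m → (F₂^ m → F₂^ m) → F₂^ m → F₂^ m
update a c f w with w ≟ᵥ a
... | yes _ = c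
... | no  _ = f w

update-at : ∀ {m} (a c : F₂^ m) f → update a c f a ≡ c
update-at a c f with a ≟ᵥ a
... | yes _  = refl
... | no a≢a = contradiction refl a≢a

update-off : ∀ {m} {a w : F₂^ m} c f → w ≢ a → update a c f w ≡ f w
update-off {a = a} {w} c f w≢a with w ≟ᵥ a
... | yes w≡a = contradiction w≡a w≢a
... | no  _   = refl

update-injective-on : ∀ {m} {D : Pred (F₂^ m) 0ℓ} {f : F₂^ m → F₂^ m} a c →
  (∀ {u v} → D u → D v → u ≢ a → v ≢ a → f u ≡ f v → u ≡ v) →
  (∀ w → D w → w ≢ a → f w ≢ c) →
  ∀ {u v} → D u → D v → update a c f u ≡ update a c f v → u ≡ v
update-injective-on a c inj missed {u} {v} Du Dv eq with u ≟ᵥ a | v ≟ᵥ a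
... | yes u≡a | yes v≡a = trans u≡a (sym v≡a)
... | yes _   | no v≢a  = contradiction (sym eq) (missed v Dv v≢a)
... | no u≢a  | yes _   = contradiction eq (missed u Du u≢a)
... | no u≢a  | no v≢a  = inj Du Dv u≢a v≢a eq

record TwoMissed {m} (a b : F₂^ m) (f : F₂^ m → F₂^ m) : Set where
  field
    missed           : Bool → F₂^ m
    missed-injective : Injective _≡_ _≡_ missed
    missed-≢         : ∀ i w → w ≢ a → w ≢ b → f w ≢ missed i
    covers           : ∀ u → (∃[ w ] (w ≢ a × w ≢ b × f w ≡ u)) ⊎ (∃[ i ] missed i ≡ u)

-- The values of `f` at `a` and `b` are discarded and replaced, one after the other, by a value
-- still missed. The outcome is an injective self-map, and its surjectivity yields `covers`.
twoMissed : ∀ {m} {a b : F₂^ m} {f : F₂^ m → F₂^ m} → a ≢ b →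
  (∀ {u v} → u ≢ a → u ≢ b → v ≢ a → v ≢ b → f u ≡ f v → u ≡ v) → TwoMissed a b f
twoMissed {m} {a} {b} {f} a≢b inj = record
  { missed = c; missed-injective = c-injective; missed-≢ = c-≢; covers = cover }
  where
  step₁ : ∃[ c ] (∀ w → w ≢ a × w ≢ b → f w ≢ c)
  step₁ = injective-on⇒missed (λ w → ¬? (w ≟ᵥ a) ×-dec ¬? (w ≟ᵥ b))
    (λ (u≢a , u≢b) (v≢a , v≢b) → inj u≢a u≢b v≢a v≢b) (a , λ (a≢a , _) → a≢a refl)
  c₁ : F₂^ m
  c₁ = proj₁ step₁
  f₁ : F₂^ m → F₂^ m
  f₁ = update a c₁ f
  f₁-injective-on : ∀ {u v} → u ≢ b → v ≢ b → f₁ u ≡ f₁ v → u ≡ v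
  f₁-injective-on = update-injective-on {D = _≢ b} a c₁
    (λ u≢b v≢b u≢a v≢a → inj u≢a u≢b v≢a v≢b)
    (λ w w≢b w≢a → proj₂ step₁ w (w≢a , w≢b))
  step₂ : ∃[ c ] (∀ w → w ≢ b → f₁ w ≢ c)
  step₂ = injective-on⇒missed (λ w → ¬? (w ≟ᵥ b)) f₁-injective-on (b , λ b≢b → b≢b refl)
  c₂ : F₂^ m
  c₂ = proj₁ step₂
  f₂-surjective : ∀ u → ∃[ w ] update b c₂ f₁ w ≡ u
  f₂-surjective = injective⇒surjective (λ {u} {v} eq →
    -- `u ≡ u` serves as the total predicate: after the second replacement injectivity holds on all
    -- vectors.
    update-injective-on {D = λ _ → u ≡ u} b c₂
      (λ _ _ → f₁-injective-on) (λ w _ → proj₂ step₂ w) refl refl eq)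
  c : Bool → F₂^ m
  c false = c₁
  c true  = c₂
  c₁≢c₂ : c₁ ≢ c₂
  c₁≢c₂ eq = proj₂ step₂ a a≢b (trans (update-at a c₁ f) eq)
  c-injective : Injective _≡_ _≡_ c
  c-injective {false} {false} _  = refl
  c-injective {false} {true}  eq = contradiction eq c₁≢c₂
  c-injective {true}  {false} eq = contradiction (sym eq) c₁≢c₂
  c-injective {true}  {true}  _  = refl
  c-≢ : ∀ i w → w ≢ a → w ≢ b → f w ≢ c i
  c-≢ false w w≢a w≢b = proj₂ step₁ w (w≢a , w≢b)
  c-≢ true  w w≢a w≢b eq = proj₂ step₂ w w≢b (trans (update-off c₁ f w≢a) eq)
  cover : ∀ u → (∃[ w ] (w ≢ a × w ≢ b × f w ≡ u)) ⊎ (∃[ i ] c i ≡ u)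
  cover u = locate (proj₁ (f₂-surjective u)) (proj₂ (f₂-surjective u)) (_ ≟ᵥ b) (_ ≟ᵥ a)
    where
    locate : ∀ w → update b c₂ f₁ w ≡ u → Dec (w ≡ b) → Dec (w ≡ a) →
      (∃[ w ] (w ≢ a × w ≢ b × f w ≡ u)) ⊎ (∃[ i ] c i ≡ u)
    locate w eq (yes refl) _          = inj₂ (true , trans (sym (update-at b c₂ f₁)) eq)
    locate w eq (no w≢b)   (yes refl) = inj₂ (false ,
      trans (sym (update-at a c₁ f)) (trans (sym (update-off c₂ f₁ w≢b)) eq))
    locate w eq (no w≢b)   (no w≢a)   = inj₁ (w , w≢a , w≢b ,
      trans (sym (update-off c₁ f w≢a)) (trans (sym (update-off c₂ f₁ w≢b)) eq))

-- Linear algebra over 𝔽₂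

module ExponentTwo {A : Set} (_∙_ : Op₂ A) (ε : A) (assoc : Associative _≡_ _∙_)
  (comm : Commutative _≡_ _∙_) (identityˡ : LeftIdentity _≡_ ε _∙_) (self : ∀ x → x ∙ x ≡ ε) where

  identityʳ : ∀ x → x ∙ ε ≡ x
  identityʳ x = trans (comm x ε) (identityˡ x)

  cancelˡ : ∀ x y → x ∙ (x ∙ y) ≡ y
  cancelˡ x y = trans (sym (assoc x x y)) (trans (cong (_∙ y) (self x)) (identityˡ y))

  ∙≡ε⇒≡ : ∀ {x y} → x ∙ y ≡ ε → x ≡ y
  ∙≡ε⇒≡ {x} {y} eq = trans (sym (identityʳ x)) (trans (cong (x ∙_) (sym eq)) (cancelˡ x y))

  ≡⇒∙≡ε : ∀ {x y} → x ≡ y → x ∙ y ≡ ε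
  ≡⇒∙≡ε {x} refl = self x

  ∙-cancelʳ : ∀ {x y z} → x ∙ z ≡ y ∙ z → x ≡ y
  ∙-cancelʳ {x} {y} {z} eq = trans (sym (cancelˡ z x))
    (trans (cong (z ∙_) (trans (comm z x) (trans eq (comm y z)))) (cancelˡ z y))

  interchange : ∀ w x y z → (w ∙ x) ∙ (y ∙ z) ≡ (w ∙ y) ∙ (x ∙ z)
  interchange w x y z = begin
    (w ∙ x) ∙ (y ∙ z) ≡⟨ assoc w x (y ∙ z) ⟩
    w ∙ (x ∙ (y ∙ z)) ≡⟨ cong (w ∙_) (sym (assoc x y z)) ⟩
    w ∙ ((x ∙ y) ∙ z) ≡⟨ cong (λ t → w ∙ (t ∙ z)) (comm x y) ⟩
    w ∙ ((y ∙ x) ∙ z) ≡⟨ cong (w ∙_) (assoc y x z) ⟩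
    w ∙ (y ∙ (x ∙ z)) ≡⟨ sym (assoc w y (x ∙ z)) ⟩
    (w ∙ y) ∙ (x ∙ z) ∎
    where open ≡-Reasoning

  idempotent⇒ε : ∀ {x} → x ≡ x ∙ x → x ≡ ε
  idempotent⇒ε {x} eq = trans eq (self x)

module 𝔹 = ExponentTwo _+₂_ 0₂ F.+-assoc F.+-comm F.+-identityˡ xor-same

+ᵥ-self : ∀ {n} (v : F₂^ n) → v +ᵥ v ≡ 0ᵥ
+ᵥ-self []      = refl
+ᵥ-self (b ∷ v) = cong₂ _∷_ (xor-same b) (+ᵥ-self v)

+ᵥ-assoc : ∀ {n} → Associative _≡_ (_+ᵥ_ {n})
+ᵥ-assoc = zipWith-assoc F.+-assoc

+ᵥ-comm : ∀ {n} → Commutative _≡_ (_+ᵥ_ {n})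
+ᵥ-comm = zipWith-comm F.+-comm

+ᵥ-identityˡ : ∀ {n} → LeftIdentity _≡_ 0ᵥ (_+ᵥ_ {n})
+ᵥ-identityˡ = zipWith-identityˡ F.+-identityˡ

+ᵣ-self : ∀ {n k} (A : Vec (F₂^ n) k) → zipWith _+ᵥ_ A A ≡ replicate k 0ᵥ
+ᵣ-self []      = refl
+ᵣ-self (r ∷ A) = cong₂ _∷_ (+ᵥ-self r) (+ᵣ-self A)

module 𝕍 {n : ℕ} = ExponentTwo (_+ᵥ_ {n}) 0ᵥ +ᵥ-assoc +ᵥ-comm +ᵥ-identityˡ +ᵥ-self

+ₘ-assoc : ∀ {n} → Associative _≡_ (_+ₘ_ {n})
+ₘ-assoc = zipWith-assoc +ᵥ-assoc

+ₘ-comm : ∀ {n} → Commutative _≡_ (_+ₘ_ {n})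
+ₘ-comm = zipWith-comm +ᵥ-comm

+ₘ-identityˡ : ∀ {n} → LeftIdentity _≡_ 0ₘ (_+ₘ_ {n})
+ₘ-identityˡ = zipWith-identityˡ +ᵥ-identityˡ

module 𝕄 {n : ℕ} = ExponentTwo (_+ₘ_ {n}) 0ₘ +ₘ-assoc +ₘ-comm +ₘ-identityˡ +ᵣ-self

dot-comm : ∀ {n} (u v : F₂^ n) → dot u v ≡ dot v u
dot-comm []      []      = refl
dot-comm (a ∷ u) (b ∷ v) = cong₂ _+₂_ (F.*-comm a b) (dot-comm u v)

dot-+ʳ : ∀ {n} (r x y : F₂^ n) → dot r (x +ᵥ y) ≡ dot r x +₂ dot r y
dot-+ʳ []      []      []      = refl
dot-+ʳ (a ∷ r) (b ∷ x) (c ∷ y) = trans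
  (cong₂ _+₂_ (F.distribˡ a b c) (dot-+ʳ r x y))
  (𝔹.interchange (a *₂ b) (a *₂ c) (dot r x) (dot r y))

dot-+ˡ : ∀ {n} (r s x : F₂^ n) → dot (r +ᵥ s) x ≡ dot r x +₂ dot s x
dot-+ˡ r s x = trans (dot-comm (r +ᵥ s) x)
  (trans (dot-+ʳ x r s) (cong₂ _+₂_ (dot-comm x r) (dot-comm x s)))

dot-0ˡ : ∀ {n} (x : F₂^ n) → dot 0ᵥ x ≡ 0₂
dot-0ˡ []      = refl
dot-0ˡ (_ ∷ x) = dot-0ˡ x

dot-·ˡ : ∀ {n} a (r x : F₂^ n) → dot (a ·ᵥ r) x ≡ a *₂ dot r x
dot-·ˡ a []      []      = sym (F.zeroʳ a)
dot-·ˡ a (b ∷ r) (c ∷ x) = trans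
  (cong₂ _+₂_ (F.*-assoc a b c) (dot-·ˡ a r x)) (sym (F.distribˡ a (b *₂ c) (dot r x)))

dot-0ʳ : ∀ {n} (r : F₂^ n) → dot r 0ᵥ ≡ 0₂
dot-0ʳ r = trans (dot-comm r 0ᵥ) (dot-0ˡ r)

-- The rectangular form of `_*ᵥ_`, so that induction can remove rows while the number of columns
-- stays fixed.
apply : ∀ {n k} → Vec (F₂^ n) k → F₂^ n → F₂^ k
apply A x = map (λ row → dot row x) A

apply-+ʳ : ∀ {n k} (A : Vec (F₂^ n) k) x y → apply A (x +ᵥ y) ≡ apply A x +ᵥ apply A y
apply-+ʳ []      x y = refl
apply-+ʳ (r ∷ A) x y = cong₂ _∷_ (dot-+ʳ r x y) (apply-+ʳ A x y)

apply-+ˡ : ∀ {n k} (A B : Vec (F₂^ n) k) x → apply (zipWith _+ᵥ_ A B) x ≡ apply A x +ᵥ apply B x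
apply-+ˡ []      []      x = refl
apply-+ˡ (r ∷ A) (s ∷ B) x = cong₂ _∷_ (dot-+ˡ r s x) (apply-+ˡ A B x)

*ᵥ-+ʳ : ∀ {n} (A : M n) x y → A *ᵥ (x +ᵥ y) ≡ A *ᵥ x +ᵥ A *ᵥ y
*ᵥ-+ʳ = apply-+ʳ

*ᵥ-+ˡ : ∀ {n} (A B : M n) x → (A +ₘ B) *ᵥ x ≡ A *ᵥ x +ᵥ B *ᵥ x
*ᵥ-+ˡ = apply-+ˡ

*ᵥ-0ʳ : ∀ {n} (A : M n) → A *ᵥ 0ᵥ ≡ 0ᵥ
*ᵥ-0ʳ A = 𝕍.idempotent⇒ε (trans (cong (A *ᵥ_) (sym (+ᵥ-self 0ᵥ))) (*ᵥ-+ʳ A 0ᵥ 0ᵥ))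

*ᵥ-0ˡ : ∀ {n} (x : F₂^ n) → 0ₘ *ᵥ x ≡ 0ᵥ
*ᵥ-0ˡ x = 𝕍.idempotent⇒ε (trans (cong (_*ᵥ x) (sym (+ᵣ-self 0ₘ))) (*ᵥ-+ˡ 0ₘ 0ₘ x))

dot-ext : ∀ {n} {r s : F₂^ n} → (∀ x → dot r x ≡ dot s x) → r ≡ s
dot-ext {r = []}    {[]}    _  = refl
dot-ext {r = a ∷ r} {b ∷ s} eq = cong₂ _∷_ a≡b
  (dot-ext (λ x → trans (sym (at-0∷ a r x)) (trans (eq (0₂ ∷ x)) (at-0∷ b s x))))
  where
  at-1∷0 : ∀ c t → dot (c ∷ t) (1₂ ∷ 0ᵥ) ≡ c
  at-1∷0 c t = trans (cong₂ _+₂_ (F.*-identityʳ c) (dot-0ʳ t)) (F.+-identityʳ c)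
  at-0∷ : ∀ c t x → dot (c ∷ t) (0₂ ∷ x) ≡ dot t x
  at-0∷ c t x = cong (_+₂ dot t x) (F.zeroʳ c)
  a≡b : a ≡ b
  a≡b = trans (sym (at-1∷0 a r)) (trans (eq (1₂ ∷ 0ᵥ)) (at-1∷0 b s))

apply-ext : ∀ {n k} {A B : Vec (F₂^ n) k} → (∀ x → apply A x ≡ apply B x) → A ≡ B
apply-ext {A = []}    {[]}    _  = refl
apply-ext {A = r ∷ A} {s ∷ B} eq = cong₂ _∷_
  (dot-ext (λ x → proj₁ (∷-injective (eq x)))) (apply-ext (λ x → proj₂ (∷-injective (eq x))))

-- The values of `φ` at the standard basis vectors.
coefficients : ∀ {n} → (F₂^ n → F₂) → F₂^ n
coefficients {zero}  φ = []
coefficients {suc n} φ = φ (1₂ ∷ 0ᵥ) ∷ coefficients (φ ∘ (0₂ ∷_))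

-- Additive maps are already linear here: the only scalars are 0 and 1, and a value equal to its own
-- double is 0.
dot-coefficients : ∀ {n} (φ : F₂^ n → F₂) → (∀ x y → φ (x +ᵥ y) ≡ φ x +₂ φ y) →
  ∀ x → dot (coefficients φ) x ≡ φ x
dot-coefficients φ add []      = sym (𝔹.idempotent⇒ε (add [] []))
dot-coefficients φ add (b ∷ x) = trans
  (cong₂ _+₂_ (first b) (dot-coefficients (φ ∘ (0₂ ∷_)) (λ u v → add (0₂ ∷ u) (0₂ ∷ v)) x))
  (trans (sym (add (b ∷ 0ᵥ) (0₂ ∷ x))) (cong φ (cong₂ _∷_ (F.+-identityʳ b) (+ᵥ-identityˡ x))))
  where
  first : ∀ b → φ (1₂ ∷ 0ᵥ) *₂ b ≡ φ (b ∷ 0ᵥ)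
  first false = trans (F.zeroʳ _) (sym (𝔹.idempotent⇒ε
    (trans (cong φ (sym (+ᵥ-self (false ∷ 0ᵥ)))) (add (false ∷ 0ᵥ) (false ∷ 0ᵥ)))))
  first true  = F.*-identityʳ _

matrix : ∀ {n} → (F₂^ n → F₂^ n) → M n
matrix g = tabulate (λ i → coefficients (λ x → lookup (g x) i))

matrix-*ᵥ : ∀ {n} (g : F₂^ n → F₂^ n) → (∀ x y → g (x +ᵥ y) ≡ g x +ᵥ g y) →
  ∀ x → matrix g *ᵥ x ≡ g x
matrix-*ᵥ g add x = begin
  matrix g *ᵥ x                                              ≡⟨ sym (tabulate∘lookup (matrix g *ᵥ x)) ⟩
  tabulate (lookup (matrix g *ᵥ x))                          ≡⟨ tabulate-cong entry ⟩
  tabulate (lookup (g x))                                    ≡⟨ tabulate∘lookup (g x) ⟩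
  g x                                                        ∎
  where
  open ≡-Reasoning
  entry : ∀ i → lookup (matrix g *ᵥ x) i ≡ lookup (g x) i
  entry i = begin
    lookup (matrix g *ᵥ x) i                        ≡⟨ lookup-map i (λ row → dot row x) (matrix g) ⟩
    dot (lookup (matrix g) i) x                     ≡⟨ cong (λ r → dot r x) (lookup∘tabulate (λ j → coefficients (λ y → lookup (g y) j)) i) ⟩
    dot (coefficients (λ y → lookup (g y) i)) x     ≡⟨ dot-coefficients (λ y → lookup (g y) i)
                                                         (λ u v → trans (cong (λ w → lookup w i) (add u v)) (lookup-zipWith _+₂_ i (g u) (g v))) x ⟩
    lookup (g x) i                                  ∎

-- The expression `(replicate n _∷_ ⊛ b) ⊛ bs` is what `transpose` unfolds to on a matrix with first
-- row `b`.
dots-∷ : ∀ {n k} a (r : F₂^ k) (b : F₂^ n) (bs : Vec (F₂^ k) n) →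
  map (dot (a ∷ r)) ((replicate n _∷_ ⊛ b) ⊛ bs) ≡ a ·ᵥ b +ᵥ map (dot r) bs
dots-∷ a r []      []       = refl
dots-∷ a r (b ∷ c) (d ∷ bs) = cong (a *₂ b +₂ dot r d ∷_) (dots-∷ a r c bs)

dots-[] : ∀ n → map (dot []) (replicate n []) ≡ 0ᵥ
dots-[] zero    = refl
dots-[] (suc n) = cong (0₂ ∷_) (dots-[] n)

dot-transpose : ∀ {n k} (r : F₂^ k) (B : Vec (F₂^ n) k) x →
  dot (map (dot r) (transpose B)) x ≡ dot r (apply B x)
dot-transpose {n} [] [] x = trans (cong (λ t → dot t x) (dots-[] n)) (dot-0ˡ x)
dot-transpose (a ∷ r) (b ∷ B) x = begin
  dot (map (dot (a ∷ r)) (transpose (b ∷ B))) x       ≡⟨ cong (λ t → dot t x) (dots-∷ a r b (transpose B)) ⟩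
  dot (a ·ᵥ b +ᵥ map (dot r) (transpose B)) x         ≡⟨ dot-+ˡ (a ·ᵥ b) _ x ⟩
  dot (a ·ᵥ b) x +₂ dot (map (dot r) (transpose B)) x ≡⟨ cong₂ _+₂_ (dot-·ˡ a b x) (dot-transpose r B x) ⟩
  a *₂ dot b x +₂ dot r (apply B x)                   ∎
  where open ≡-Reasoning

rows-* : ∀ {n k} (A : Vec (F₂^ n) k) (B : M n) x →
  apply (map (λ row → map (dot row) (transpose B)) A) x ≡ apply A (B *ᵥ x)
rows-* []      B x = refl
rows-* (r ∷ A) B x = cong₂ _∷_ (dot-transpose r B x) (rows-* A B x)

*ₘ-*ᵥ : ∀ {n} (A B : M n) x → (A *ₘ B) *ᵥ x ≡ A *ᵥ (B *ᵥ x)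
*ₘ-*ᵥ = rows-*

-- The tail of 1ₘ {suc n} is definitionally built from 1ₘ {n} although the local function behind
-- 1ₘ carries the outer dimension: conversion ignores that unused argument.
1ₘ-*ᵥ : ∀ {n} (x : F₂^ n) → 1ₘ *ᵥ x ≡ x
1ₘ-*ᵥ         []      = refl
1ₘ-*ᵥ {suc n} (b ∷ x) = cong₂ _∷_
  (trans (cong (b +₂_) (dot-0ˡ x)) (F.+-identityʳ b)) (trans (shift 1ₘ) (1ₘ-*ᵥ x))
  where
  shift : ∀ {k} (A : Vec (F₂^ n) k) → apply (map (0₂ ∷_) A) (b ∷ x) ≡ apply A x
  shift []      = refl
  shift (_ ∷ A) = cong (_ ∷_) (shift A)

Nonsingular : ∀ {n} → M n → Set
Nonsingular A = ∀ w → A *ᵥ w ≡ 0ᵥ → w ≡ 0ᵥ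

*ᵥ-agree⇒+-kills : ∀ {n} (A B : M n) {x} → A *ᵥ x ≡ B *ᵥ x → (A +ₘ B) *ᵥ x ≡ 0ᵥ
*ᵥ-agree⇒+-kills A B {x} eq = trans (*ᵥ-+ˡ A B x) (𝕍.≡⇒∙≡ε eq)

+-kills⇒*ᵥ-agree : ∀ {n} (A B : M n) {x} → (A +ₘ B) *ᵥ x ≡ 0ᵥ → A *ᵥ x ≡ B *ᵥ x
+-kills⇒*ᵥ-agree A B {x} eq = 𝕍.∙≡ε⇒≡ (trans (sym (*ᵥ-+ˡ A B x)) eq)

nonsingular-injective : ∀ {n} {A : M n} → Nonsingular A → Injective _≡_ _≡_ (A *ᵥ_)
nonsingular-injective {A = A} ns {x} {y} eq =
  𝕍.∙≡ε⇒≡ (ns (x +ᵥ y) (trans (*ᵥ-+ʳ A x y) (𝕍.≡⇒∙≡ε eq)))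

-- Injectivity makes `A` bijective on vectors. The inverse map is additive and so comes from a
-- matrix; that it is also a left inverse follows by cancelling `A`.
nonsingular⇒invertible : ∀ {n} {A : M n} → Nonsingular A → Invertible A
nonsingular⇒invertible {n} {A} ns = matrix inverse ,
  apply-ext (λ x → trans (*ₘ-*ᵥ A B x) (trans (AB x) (sym (1ₘ-*ᵥ x)))) ,
  apply-ext (λ x → trans (*ₘ-*ᵥ B A x) (trans (A-injective (AB (A *ᵥ x))) (sym (1ₘ-*ᵥ x))))
  where
  A-injective : Injective _≡_ _≡_ (A *ᵥ_)
  A-injective = nonsingular-injective ns
  inverse : F₂^ n → F₂^ n
  inverse v = proj₁ (injective⇒surjective A-injective v)
  A-inverse : ∀ v → A *ᵥ inverse v ≡ v
  A-inverse v = proj₂ (injective⇒surjective A-injective v)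
  inverse-+ : ∀ u v → inverse (u +ᵥ v) ≡ inverse u +ᵥ inverse v
  inverse-+ u v = A-injective (trans (A-inverse (u +ᵥ v))
    (sym (trans (*ᵥ-+ʳ A (inverse u) (inverse v)) (cong₂ _+ᵥ_ (A-inverse u) (A-inverse v)))))
  B : M n
  B = matrix inverse
  AB : ∀ x → A *ᵥ (B *ᵥ x) ≡ x
  AB x = trans (cong (A *ᵥ_) (matrix-*ᵥ inverse inverse-+ x)) (A-inverse x)

singular? : ∀ {n} (A : M n) → Nonsingular A ⊎ ∃[ w ] (w ≢ 0ᵥ × A *ᵥ w ≡ 0ᵥ)
singular? A with exists? (λ w → ¬? (w ≟ᵥ 0ᵥ) ×-dec ((A *ᵥ w) ≟ᵥ 0ᵥ))
... | yes found = inj₂ found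
... | no  none  = inj₁ nonsingular
  where
  nonsingular : Nonsingular A
  nonsingular w eq with w ≟ᵥ 0ᵥ
  ... | yes w≡0 = w≡0
  ... | no  w≢0 = contradiction (w , w≢0 , eq) none

nonsingular? : ∀ {n} → Decidable (Nonsingular {n})
nonsingular? A with singular? A
... | inj₁ ns             = yes ns
... | inj₂ (w , w≢0 , Aw) = no λ ns → w≢0 (ns w Aw)

·ᵥ-distribʳ : ∀ {n} a b (v : F₂^ n) → (a +₂ b) ·ᵥ v ≡ a ·ᵥ v +ᵥ b ·ᵥ v
·ᵥ-distribʳ a b []      = refl
·ᵥ-distribʳ a b (c ∷ v) = cong₂ _∷_ (F.distribʳ c a b) (·ᵥ-distribʳ a b v)

linearCombination-+ : ∀ {n r} (cs ds : Vec F₂ r) (vs : Vec (F₂^ n) r) →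
  linearCombination (cs +ᵥ ds) vs ≡ linearCombination cs vs +ᵥ linearCombination ds vs
linearCombination-+ []       []       []       = sym (+ᵥ-self 0ᵥ)
linearCombination-+ (c ∷ cs) (d ∷ ds) (v ∷ vs) = trans
  (cong₂ _+ᵥ_ (·ᵥ-distribʳ c d v) (linearCombination-+ cs ds vs))
  (𝕍.interchange (c ·ᵥ v) (d ·ᵥ v) (linearCombination cs vs) (linearCombination ds vs))

independent⇒injective : ∀ {n r} {vs : Vec (F₂^ n) r} → LinearlyIndependent vs →
  Injective _≡_ _≡_ (λ cs → linearCombination cs vs)
independent⇒injective {vs = vs} independent {cs} {ds} eq =
  𝕍.∙≡ε⇒≡ (independent (cs +ᵥ ds) (trans (linearCombination-+ cs ds vs) (𝕍.≡⇒∙≡ε eq)))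

false-· : ∀ {n} (v : F₂^ n) → false ·ᵥ v ≡ 0ᵥ
false-· []      = refl
false-· (_ ∷ v) = cong (false ∷_) (false-· v)

true-· : ∀ {n} (v : F₂^ n) → true ·ᵥ v ≡ v
true-· []      = refl
true-· (b ∷ v) = cong (b ∷_) (true-· v)

lc-pair : ∀ {n} a b (x y : F₂^ n) → linearCombination (a ∷ b ∷ []) (x ∷ y ∷ []) ≡ a ·ᵥ x +ᵥ b ·ᵥ y
lc-pair a b x y = cong (a ·ᵥ x +ᵥ_) (𝕍.identityʳ (b ·ᵥ y))

-- Special to 𝔽₂: a nontrivial relation can only say `x = 0`, `y = 0` or `x = y`.
distinct-independent : ∀ {n} {x y : F₂^ n} → x ≢ 0ᵥ → y ≢ 0ᵥ → x ≢ y → LinearlyIndependent (x ∷ y ∷ [])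
distinct-independent {x = x} {y} x≢0 y≢0 x≢y (a ∷ b ∷ []) eq = go a b (𝕍.∙≡ε⇒≡ (trans (sym (lc-pair a b x y)) eq))
  where
  go : ∀ a b → a ·ᵥ x ≡ b ·ᵥ y → a ∷ b ∷ [] ≡ 0ᵥ
  go false false _  = refl
  go false true  eq = contradiction (trans (sym (true-· y)) (trans (sym eq) (false-· x))) y≢0
  go true  false eq = contradiction (trans (sym (true-· x)) (trans eq (false-· y))) x≢0
  go true  true  eq = contradiction (trans (sym (true-· x)) (trans eq (true-· y))) x≢y

lc-kernel : ∀ {n} (A : M n) {x y} a b → A *ᵥ x ≡ 0ᵥ → A *ᵥ y ≡ 0ᵥ →
  A *ᵥ linearCombination (a ∷ b ∷ []) (x ∷ y ∷ []) ≡ 0ᵥ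
lc-kernel A {x} {y} a b Ax Ay = begin
  A *ᵥ linearCombination (a ∷ b ∷ []) (x ∷ y ∷ []) ≡⟨ cong (A *ᵥ_) (lc-pair a b x y) ⟩
  A *ᵥ (a ·ᵥ x +ᵥ b ·ᵥ y)                          ≡⟨ *ᵥ-+ʳ A _ _ ⟩
  A *ᵥ (a ·ᵥ x) +ᵥ A *ᵥ (b ·ᵥ y)                   ≡⟨ cong₂ _+ᵥ_ (scaled a Ax) (scaled b Ay) ⟩
  0ᵥ +ᵥ 0ᵥ                                         ≡⟨ +ᵥ-self 0ᵥ ⟩
  0ᵥ                                               ∎
  where
  open ≡-Reasoning
  scaled : ∀ c {v} → A *ᵥ v ≡ 0ᵥ → A *ᵥ (c ·ᵥ v) ≡ 0ᵥ
  scaled false {v} _  = trans (cong (A *ᵥ_) (false-· v)) (*ᵥ-0ʳ A)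
  scaled true  {v} eq = trans (cong (A *ᵥ_) (true-· v)) eq

-- Adding the span of x and y to preimages of the image embeds F₂^(2 + rank) into F₂^n.
rank+2≤n : ∀ {n r} (A : M n) {x y} → HasRank A r → x ≢ 0ᵥ → y ≢ 0ᵥ → x ≢ y →
  A *ᵥ x ≡ 0ᵥ → A *ᵥ y ≡ 0ᵥ → suc (suc r) ≤ n
rank+2≤n {n} {r} A {x} {y} (vs , independent , spans) x≢0 y≢0 x≢y Ax Ay = injective⇒dim≤ embed-injective
  where
  preimage : ∀ cs → Image A (linearCombination cs vs)
  preimage cs = Equivalence.from (spans _) (cs , refl)
  embed : F₂^ (suc (suc r)) → F₂^ n
  embed (a ∷ b ∷ cs) = linearCombination (a ∷ b ∷ []) (x ∷ y ∷ []) +ᵥ proj₁ (preimage cs)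
  A-embed : ∀ a b cs → A *ᵥ embed (a ∷ b ∷ cs) ≡ linearCombination cs vs
  A-embed a b cs = trans (*ᵥ-+ʳ A _ _)
    (trans (cong₂ _+ᵥ_ (lc-kernel A a b Ax Ay) (proj₂ (preimage cs))) (+ᵥ-identityˡ _))
  embed-injective : Injective _≡_ _≡_ embed
  embed-injective {a ∷ b ∷ cs} {c ∷ d ∷ ds} eq
    -- Applying `A` erases the kernel part and recovers `cs`. After `cs` and `ds` are identified,
    -- the chosen preimages are the same vector and cancel.
    with refl ← independent⇒injective independent {cs} {ds}
                  (trans (sym (A-embed a b cs)) (trans (cong (A *ᵥ_) eq) (A-embed c d ds)))
    with refl ← independent⇒injective (distinct-independent x≢0 y≢0 x≢y) {a ∷ b ∷ []} {c ∷ d ∷ []}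
                  (𝕍.∙-cancelʳ eq)
    = refl

-- Codes of minimum distance n − 1

-- The rank condition enters as `kernel≤1`. The hypothesis `other` expresses n ≥ 2: it supplies the
-- second vector needed to tell apart elements that agree at `x`.
module Code {n : ℕ} (C : Pred (M n) 0ℓ) (C-+ : AdditivelyClosed C)
  (C-card : HasCardinality C (2 ^ (2 * n)))
  (kernel≤1 : ∀ {A x y} → A ∈ C → x ≢ 0ᵥ → y ≢ 0ᵥ → x ≢ y → A *ᵥ x ≡ 0ᵥ → A *ᵥ y ≡ 0ᵥ → A ≡ 0ₘ)
  (other : ∀ (x : F₂^ n) → ∃[ y ] (y ≢ 0ᵥ × x ≢ y)) where

  private
    V : Set
    V = F₂^ n

  determined : ∀ {A B x y} → A ∈ C → B ∈ C → x ≢ 0ᵥ → y ≢ 0ᵥ → x ≢ y →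
    A *ᵥ x ≡ B *ᵥ x → A *ᵥ y ≡ B *ᵥ y → A ≡ B
  determined {A} {B} A∈C B∈C x≢0 y≢0 x≢y eqx eqy = 𝕄.∙≡ε⇒≡
    (kernel≤1 (C-+ A B A∈C B∈C) x≢0 y≢0 x≢y (*ᵥ-agree⇒+-kills A B eqx) (*ᵥ-agree⇒+-kills A B eqy))

  abstract
    interpolate : ∀ {x y} → x ≢ 0ᵥ → y ≢ 0ᵥ → x ≢ y → ∀ u v →
      ∃[ A ] (A ∈ C × A *ᵥ x ≡ u × A *ᵥ y ≡ v)
    interpolate {x} {y} x≢0 y≢0 x≢y u v =
      -- `2 * n` unfolds to `n + (n + 0)`, whence the final `[]`. `values` is an injective self-map
      -- because the code has as many elements as there are pairs of vectors.
      let i , eq  = Fin-injective⇒surjective values-injective (encode (u ++ (v ++ [])))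
          eqs     = ++-injective (f i *ᵥ x) u (encode-injective {2 * n} eq)
      in f i , f∈C i , proj₁ eqs , proj₁ (++-injective (f i *ᵥ y) v (proj₂ eqs))
      where
      f : Fin (2 ^ (2 * n)) → M n
      f = proj₁ C-card
      f∈C : ∀ i → f i ∈ C
      f∈C i = Equivalence.from (proj₂ (proj₂ C-card) (f i)) (i , refl)
      values : Fin (2 ^ (2 * n)) → Fin (2 ^ (2 * n))
      values i = encode (f i *ᵥ x ++ (f i *ᵥ y ++ []))
      values-injective : Injective _≡_ _≡_ values
      values-injective {i} {j} eq =
        let eqs = ++-injective (f i *ᵥ x) (f j *ᵥ x) (encode-injective {2 * n} eq)
        in proj₁ (proj₂ C-card) (determined (f∈C i) (f∈C j) x≢0 y≢0 x≢y
             (proj₁ eqs) (proj₁ (++-injective (f i *ᵥ y) (f j *ᵥ y) (proj₂ eqs))))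

  nonsingular≢0 : ∀ {A : M n} {x} → Nonsingular A → x ≢ 0ᵥ → A *ᵥ x ≢ 0ᵥ
  nonsingular≢0 ns x≢0 eq = x≢0 (ns _ eq)

  -- The two nonsingular elements with a prescribed value

  record NonsingularPair (x v : V) (t : Bool → M n) : Set where
    field
      t∈C           : ∀ i → t i ∈ C
      t-nonsingular : ∀ i → Nonsingular (t i)
      t-value       : ∀ i → t i *ᵥ x ≡ v
      t-injective   : Injective _≡_ _≡_ t
      t-covers      : ∀ {A} → A ∈ C → Nonsingular A → A *ᵥ x ≡ v → ∃[ i ] t i ≡ A

  -- The 2ⁿ elements of C sending x to v ≠ 0 are determined by their value at a further
  -- vector; for each w other than 0 and x exactly one of them vanishes at w, leaving two.
  module _ {x v : V} (x≢0 : x ≢ 0ᵥ) (v≢0 : v ≢ 0ᵥ) where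
    private
      y : V
      y = proj₁ (other x)
      y≢0 : y ≢ 0ᵥ
      y≢0 = proj₁ (proj₂ (other x))
      x≢y : x ≢ y
      x≢y = proj₂ (proj₂ (other x))

      -- Nothing is demanded at `w = 0` and `w = x`, so that `value-at-y` is defined on all of `V`,
      -- as `twoMissed` expects.
      Vanishing : V → Set
      Vanishing w = ∃[ A ] (A ∈ C × A *ᵥ x ≡ v × (w ≢ 0ᵥ → w ≢ x → A *ᵥ w ≡ 0ᵥ))

      vanishing′ : ∀ w → Dec (w ≡ 0ᵥ) → Dec (w ≡ x) → Vanishing w
      vanishing′ w (no w≢0) (no w≢x) =
        let A , A∈C , Ax , Aw = interpolate x≢0 w≢0 (w≢x ∘ sym) v 0ᵥ in A , A∈C , Ax , λ _ _ → Aw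
      vanishing′ w (yes w≡0) _ =
        let A , A∈C , Ax , _ = interpolate x≢0 y≢0 x≢y v 0ᵥ
        in A , A∈C , Ax , λ w≢0 _ → contradiction w≡0 w≢0
      vanishing′ w (no _) (yes w≡x) =
        let A , A∈C , Ax , _ = interpolate x≢0 y≢0 x≢y v 0ᵥ
        in A , A∈C , Ax , λ _ w≢x → contradiction w≡x w≢x

      vanishing : ∀ w → Vanishing w
      vanishing w = vanishing′ w (w ≟ᵥ 0ᵥ) (w ≟ᵥ x)

      value-at-y : V → V
      value-at-y w = proj₁ (vanishing w) *ᵥ y

      vanishing-unique : ∀ {A w} → A ∈ C → A *ᵥ x ≡ v → w ≢ 0ᵥ → A *ᵥ w ≡ 0ᵥ →
        w ≢ x × A ≡ proj₁ (vanishing w)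
      vanishing-unique {A} {w} A∈C Ax w≢0 Aw =
        let B , B∈C , Bx , Bw = vanishing w
        in w≢x , determined A∈C B∈C x≢0 w≢0 (w≢x ∘ sym) (trans Ax (sym Bx)) (trans Aw (sym (Bw w≢0 w≢x)))
        where
        w≢x : w ≢ x
        w≢x refl = v≢0 (trans (sym Ax) Aw)

      -- Equal values at `y`, besides the common value at `x`, make the two elements equal. That
      -- element then vanishes at both `u` and `w`, so `u ≢ w` would make it zero, against its value
      -- `v` at `x`.
      value-at-y-injective : ∀ {u w} → u ≢ 0ᵥ → u ≢ x → w ≢ 0ᵥ → w ≢ x →
        value-at-y u ≡ value-at-y w → u ≡ w
      value-at-y-injective {u} {w} u≢0 u≢x w≢0 w≢x eq = compare (u ≟ᵥ w)
        where
        A = proj₁ (vanishing u)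
        B = proj₁ (vanishing w)
        A∈C = proj₁ (proj₂ (vanishing u))
        Ax = proj₁ (proj₂ (proj₂ (vanishing u)))
        A≡B : A ≡ B
        A≡B = determined A∈C (proj₁ (proj₂ (vanishing w))) x≢0 y≢0 x≢y
          (trans Ax (sym (proj₁ (proj₂ (proj₂ (vanishing w)))))) eq
        compare : Dec (u ≡ w) → u ≡ w
        compare (yes u≡w) = u≡w
        compare (no u≢w)  = contradiction (trans (sym Ax) (trans (cong (_*ᵥ x) A≡0) (*ᵥ-0ˡ x))) v≢0
          where
          A≡0 : A ≡ 0ₘ
          A≡0 = kernel≤1 A∈C u≢0 w≢0 u≢w (proj₂ (proj₂ (proj₂ (vanishing u))) u≢0 u≢x)
            (trans (cong (_*ᵥ w) A≡B) (proj₂ (proj₂ (proj₂ (vanishing w))) w≢0 w≢x))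

      open TwoMissed (twoMissed {a = 0ᵥ} {b = x} {f = value-at-y} (x≢0 ∘ sym) value-at-y-injective)

      -- A value at `y` missed by `value-at-y` belongs to an element that vanishes at no nonzero
      -- vector.
      t : Bool → M n
      t i = proj₁ (interpolate x≢0 y≢0 x≢y v (missed i))
      t∈C : ∀ i → t i ∈ C
      t∈C i = proj₁ (proj₂ (interpolate x≢0 y≢0 x≢y v (missed i)))
      tx : ∀ i → t i *ᵥ x ≡ v
      tx i = proj₁ (proj₂ (proj₂ (interpolate x≢0 y≢0 x≢y v (missed i))))
      ty : ∀ i → t i *ᵥ y ≡ missed i
      ty i = proj₂ (proj₂ (proj₂ (interpolate x≢0 y≢0 x≢y v (missed i))))

      t-ns : ∀ i → Nonsingular (t i)
      t-ns i w tw = decide (w ≟ᵥ 0ᵥ)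
        where
        decide : Dec (w ≡ 0ᵥ) → w ≡ 0ᵥ
        decide (yes w≡0) = w≡0
        decide (no w≢0)  =
          let w≢x , eq = vanishing-unique (t∈C i) (tx i) w≢0 tw
          in contradiction (trans (cong (_*ᵥ y) (sym eq)) (ty i)) (missed-≢ i w w≢0 w≢x)

      cover : ∀ {A} → A ∈ C → Nonsingular A → A *ᵥ x ≡ v → ∃[ i ] t i ≡ A
      cover {A} A∈C ns Ax = locate (covers (A *ᵥ y))
        where
        locate : (∃[ w ] (w ≢ 0ᵥ × w ≢ x × value-at-y w ≡ A *ᵥ y)) ⊎ (∃[ i ] missed i ≡ A *ᵥ y) → ∃[ i ] t i ≡ A
        locate (inj₁ (w , w≢0 , w≢x , eq)) =
          let B , B∈C , Bx , Bw = vanishing w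
              B≡A = determined B∈C A∈C x≢0 y≢0 x≢y (trans Bx (sym Ax)) eq
          in contradiction (trans (cong (_*ᵥ w) (sym B≡A)) (Bw w≢0 w≢x)) (nonsingular≢0 ns w≢0)
        locate (inj₂ (i , eq)) =
          i , determined (t∈C i) A∈C x≢0 y≢0 x≢y (trans (tx i) (sym Ax)) (trans (ty i) eq)

    abstract
      nonsingularPair : ∃[ t ] NonsingularPair x v t
      nonsingularPair = t , record
        { t∈C = t∈C; t-nonsingular = t-ns; t-value = tx
        ; t-injective = λ {i} {j} eq → missed-injective (trans (sym (ty i)) (trans (cong (_*ᵥ y) eq) (ty j)))
        ; t-covers = cover }

  private
    -- The default `0ₘ` at `v = 0` is chosen so that `pairSum x 0ᵥ` is `0ₘ`, which lets `pairSum x`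
    -- attain the zero matrix as well.
    pair′ : ∀ x v → Dec (x ≡ 0ᵥ) → Dec (v ≡ 0ᵥ) →
      Σ[ t ∈ (Bool → M n) ] ((x ≢ 0ᵥ → v ≢ 0ᵥ → NonsingularPair x v t) × (v ≡ 0ᵥ → ∀ i → t i ≡ 0ₘ))
    pair′ x v (no x≢0) (no v≢0) =
      let t , props = nonsingularPair x≢0 v≢0 in t , (λ _ _ → props) , λ v≡0 → contradiction v≡0 v≢0
    pair′ x v (yes x≡0) _ = (λ _ → 0ₘ) , (λ x≢0 → contradiction x≡0 x≢0) , λ _ _ → refl
    pair′ x v (no _) (yes v≡0) = (λ _ → 0ₘ) , (λ _ v≢0 → contradiction v≡0 v≢0) , λ _ _ → refl

  abstract
    pair : V → V → Bool → M n
    pair x v = proj₁ (pair′ x v (x ≟ᵥ 0ᵥ) (v ≟ᵥ 0ᵥ))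

    pair-0 : ∀ x i → pair x 0ᵥ i ≡ 0ₘ
    pair-0 x = proj₂ (proj₂ (pair′ x 0ᵥ (x ≟ᵥ 0ᵥ) (0ᵥ ≟ᵥ 0ᵥ))) refl

    pair-props : ∀ {x v} → x ≢ 0ᵥ → v ≢ 0ᵥ → NonsingularPair x v (pair x v)
    pair-props {x} {v} = proj₁ (proj₂ (pair′ x v (x ≟ᵥ 0ᵥ) (v ≟ᵥ 0ᵥ)))

  module Pair {x v : V} (x≢0 : x ≢ 0ᵥ) (v≢0 : v ≢ 0ᵥ) = NonsingularPair (pair-props x≢0 v≢0)

  pair-distinct : ∀ {x v} → x ≢ 0ᵥ → v ≢ 0ᵥ → pair x v false ≢ pair x v true
  pair-distinct x≢0 v≢0 eq with () ← Pair.t-injective x≢0 v≢0 eq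

  at-most-two : ∀ {h k l y} → h ∈ C → Nonsingular h → k ∈ C → Nonsingular k → l ∈ C → Nonsingular l →
    y ≢ 0ᵥ → k *ᵥ y ≡ h *ᵥ y → l *ᵥ y ≡ h *ᵥ y → k ≢ h → l ≢ h → k ≡ l
  at-most-two {h} {k} {l} {y} h∈C h-ns k∈C k-ns l∈C l-ns y≢0 ky ly k≢h l≢h =
    compare (P.t-covers h∈C h-ns refl) (P.t-covers k∈C k-ns ky) (P.t-covers l∈C l-ns ly)
    where
    module P = Pair {y} {h *ᵥ y} y≢0 (nonsingular≢0 h-ns y≢0)
    compare : ∃[ i ] pair y (h *ᵥ y) i ≡ h → ∃[ i ] pair y (h *ᵥ y) i ≡ k → ∃[ i ] pair y (h *ᵥ y) i ≡ l → k ≡ l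
    compare (_     , _)  (false , ek) (false , el) = trans (sym ek) el
    compare (_     , _)  (true  , ek) (true  , el) = trans (sym ek) el
    compare (false , eh) (false , ek) (true  , el) = contradiction (trans (sym ek) eh) k≢h
    compare (true  , eh) (false , ek) (true  , el) = contradiction (trans (sym el) eh) l≢h
    compare (false , eh) (true  , ek) (false , el) = contradiction (trans (sym el) eh) l≢h
    compare (true  , eh) (true  , ek) (false , el) = contradiction (trans (sym ek) eh) k≢h

  -- Singular elements are sums of two nonsingular ones in exactly one way

  module _ {x z} (x≢0 : x ≢ 0ᵥ) (z∈C : z ∈ C) (zx : z *ᵥ x ≡ 0ᵥ) (z≢0 : z ≢ 0ₘ) where

    private
      z-at : ∀ {w} → w ≢ 0ᵥ → x ≢ w → z *ᵥ w ≢ 0ᵥ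
      z-at w≢0 x≢w zw = z≢0 (kernel≤1 z∈C x≢0 w≢0 x≢w zx zw)

      Shiftable : F₂^ (suc n) → Set
      Shiftable (i ∷ v) = v ≢ 0ᵥ × Nonsingular (pair x v i +ₘ z)

      -- `i ∷ v` stands for the nonsingular element `pair x v i`. Its label `j ∷ w` records a vector
      -- `w` where it agrees with `z` and its position `j` in the pair sending `w` to `z *ᵥ w`. The
      -- two entries with `v = 0` are padding, labelled by themselves.
      Label : F₂^ (suc n) → F₂^ (suc n) → Set
      Label (i ∷ v) (j ∷ w) =
        (v ≡ 0ᵥ × w ≡ 0ᵥ × i ≡ j) ⊎
        (v ≢ 0ᵥ × w ≢ 0ᵥ × x ≢ w × pair w (z *ᵥ w) j ≡ pair x v i)

      label′ : ∀ i v → Dec (v ≡ 0ᵥ) → Nonsingular (pair x v i +ₘ z) ⊎ ∃[ w ] (w ≢ 0ᵥ × (pair x v i +ₘ z) *ᵥ w ≡ 0ᵥ) →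
        Shiftable (i ∷ v) ⊎ ∃[ l ] Label (i ∷ v) l
      label′ i v (yes v≡0) _ = inj₂ (i ∷ v , inj₁ (v≡0 , v≡0 , refl))
      label′ i v (no v≢0) (inj₁ ns) = inj₁ (v≢0 , ns)
      label′ i v (no v≢0) (inj₂ (w , w≢0 , kills)) =
        let j , eq = Pair.t-covers w≢0 (z-at w≢0 x≢w) (T.t∈C i) (T.t-nonsingular i) agree
        in inj₂ (j ∷ w , inj₂ (v≢0 , w≢0 , x≢w , eq))
        where
        module T = Pair x≢0 v≢0
        agree : pair x v i *ᵥ w ≡ z *ᵥ w
        agree = +-kills⇒*ᵥ-agree (pair x v i) z kills
        x≢w : x ≢ w
        x≢w refl = v≢0 (trans (sym (T.t-value i)) (trans agree zx))

      label : ∀ iv → Shiftable iv ⊎ ∃[ l ] Label iv l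
      label (i ∷ v) = label′ i v (v ≟ᵥ 0ᵥ) (singular? (pair x v i +ₘ z))

      -- A proper label determines the matrix; its value at `x` gives back `v`, and then `i`.
      -- Padding is recognised by `w = 0`.
      label-injective : ∀ {p q l} → Label p l → Label q l → p ≡ q
      label-injective {_ ∷ _} {_ ∷ _} {_ ∷ _} (inj₁ (refl , _ , refl)) (inj₁ (refl , _ , refl)) = refl
      label-injective {_ ∷ _} {_ ∷ _} {_ ∷ _} (inj₁ (_ , w≡0 , _)) (inj₂ (_ , w≢0 , _)) = contradiction w≡0 w≢0
      label-injective {_ ∷ _} {_ ∷ _} {_ ∷ _} (inj₂ (_ , w≢0 , _)) (inj₁ (_ , w≡0 , _)) = contradiction w≡0 w≢0
      label-injective {i ∷ v} {k ∷ u} {_ ∷ _} (inj₂ (v≢0 , _ , _ , ev)) (inj₂ (u≢0 , _ , _ , eu)) =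
        same (trans (sym (Pair.t-value x≢0 v≢0 i)) (trans (cong (_*ᵥ x) eq) (Pair.t-value x≢0 u≢0 k))) eq
        where
        eq : pair x v i ≡ pair x u k
        eq = trans (sym ev) eu
        same : v ≡ u → pair x v i ≡ pair x u k → i ∷ v ≡ k ∷ u
        same refl eq = cong (_∷ v) (Pair.t-injective x≢0 v≢0 eq)

      Shiftable? : Decidable Shiftable
      Shiftable? (i ∷ v) = ¬? (v ≟ᵥ 0ᵥ) ×-dec nonsingular? (pair x v i +ₘ z)

    abstract
      -- If no nonsingular h had h + z nonsingular, each of the 2(2ⁿ − 1) nonsingular h would
      -- agree with z at some w other than 0 and x, but only two do so for each w.
      shiftable : ∃[ v ] ∃[ i ] (v ≢ 0ᵥ × Nonsingular (pair x v i +ₘ z))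
      shiftable = decide (exists? Shiftable?)
        where
        decide : Dec (∃ Shiftable) → ∃[ v ] ∃[ i ] (v ≢ 0ᵥ × Nonsingular (pair x v i +ₘ z))
        decide (yes (i ∷ v , found)) = v , i , found
        decide (no none) = ⊥-elim (excluded (proj₁ hit) (subst (Label (proj₁ hit)) (proj₂ hit) (proj₂ (labelled (proj₁ hit)))))
          where
          labelled : ∀ p → ∃[ l ] Label p l
          labelled p = pick (label p)
            where
            pick : Shiftable p ⊎ ∃[ l ] Label p l → ∃[ l ] Label p l
            pick (inj₁ s) = contradiction (p , s) none
            pick (inj₂ l) = l
          -- No label ends in `x`: padding ends in `0ᵥ`, and `z` vanishes at `x` where `pair x v i`
          -- does not. Hence `false ∷ x` contradicts surjectivity.
          hit : ∃[ p ] proj₁ (labelled p) ≡ false ∷ x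
          hit = injective⇒surjective (λ {p} {q} eq →
            label-injective (proj₂ (labelled p)) (subst (Label q) (sym eq) (proj₂ (labelled q)))) (false ∷ x)
          excluded : ∀ p → Label p (false ∷ x) → ⊥
          excluded (_ ∷ _) (inj₁ (_ , x≡0 , _))     = x≢0 x≡0
          excluded (_ ∷ _) (inj₂ (_ , _ , x≢x , _)) = x≢x refl

    -- Since `z` vanishes at `x`, both `h` and `h +ₘ z` send `x` to the same vector, so they make up
    -- the whole pair there.
    pair-shift : ∀ {h} → h ∈ C → Nonsingular h → Nonsingular (h +ₘ z) →
      pair x (h *ᵥ x) false +ₘ pair x (h *ᵥ x) true ≡ z ×
      (∀ {k} → k ∈ C → Nonsingular k → k *ᵥ x ≡ h *ᵥ x → k ≡ h ⊎ k ≡ h +ₘ z)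
    pair-shift {h} h∈C h-ns hz-ns = go (T.t-covers h∈C h-ns refl)
      (T.t-covers (C-+ h z h∈C z∈C) hz-ns (trans (*ᵥ-+ˡ h z x) (trans (cong (h *ᵥ x +ᵥ_) zx) (𝕍.identityʳ _))))
      where
      module T = Pair {x} {h *ᵥ x} x≢0 (nonsingular≢0 h-ns x≢0)
      t : Bool → M n
      t = pair x (h *ᵥ x)
      h≢h+z : h ≢ h +ₘ z
      h≢h+z eq = z≢0 (trans (sym (𝕄.cancelˡ h z)) (𝕄.≡⇒∙≡ε eq))
      go : ∃[ i ] t i ≡ h → ∃[ i ] t i ≡ h +ₘ z → t false +ₘ t true ≡ z ×
        (∀ {k} → k ∈ C → Nonsingular k → k *ᵥ x ≡ h *ᵥ x → k ≡ h ⊎ k ≡ h +ₘ z)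
      go (false , eh) (false , ez) = contradiction (trans (sym eh) ez) h≢h+z
      go (true  , eh) (true  , ez) = contradiction (trans (sym eh) ez) h≢h+z
      go (false , eh) (true  , ez) = trans (cong₂ _+ₘ_ eh ez) (𝕄.cancelˡ h z) ,
        λ k∈C k-ns kx → choose (T.t-covers k∈C k-ns kx)
        where
        choose : ∀ {k} → ∃[ i ] t i ≡ k → k ≡ h ⊎ k ≡ h +ₘ z
        choose (false , ek) = inj₁ (trans (sym ek) eh)
        choose (true  , ek) = inj₂ (trans (sym ek) ez)
      go (true  , eh) (false , ez) = trans (+ₘ-comm _ _) (trans (cong₂ _+ₘ_ eh ez) (𝕄.cancelˡ h z)) ,
        λ k∈C k-ns kx → choose (T.t-covers k∈C k-ns kx)
        where
        choose : ∀ {k} → ∃[ i ] t i ≡ k → k ≡ h ⊎ k ≡ h +ₘ z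
        choose (true  , ek) = inj₁ (trans (sym ek) eh)
        choose (false , ek) = inj₂ (trans (sym ek) ez)

  pairSum : V → V → M n
  pairSum x v = pair x v false +ₘ pair x v true

  abstract
    -- v ↦ pairSum x v is a surjection from V to the elements of C vanishing at x, two sets
    -- of the same size.
    pairSum-injective : ∀ {x u v} → x ≢ 0ᵥ → pairSum x u ≡ pairSum x v → u ≡ v
    pairSum-injective {x} {u} {v} x≢0 eq =
      surjective⇒injective {f = λ v → pairSum x v *ᵥ y} surjective {u} {v} (cong (_*ᵥ y) eq)
      where
      y : V
      y = proj₁ (other x)
      y≢0 : y ≢ 0ᵥ
      y≢0 = proj₁ (proj₂ (other x))
      x≢y : x ≢ y
      x≢y = proj₂ (proj₂ (other x))
      hit : ∀ u → Dec (u ≡ 0ᵥ) → ∃[ v ] pairSum x v *ᵥ y ≡ u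
      hit u (yes refl) = 0ᵥ , trans (cong (_*ᵥ y) (trans (cong₂ _+ₘ_ (pair-0 x false) (pair-0 x true)) (+ₘ-identityˡ 0ₘ))) (*ᵥ-0ˡ y)
      hit u (no u≢0) =
        let z , z∈C , zx , zy = interpolate x≢0 y≢0 x≢y 0ᵥ u
            z≢0 = λ z≡0 → u≢0 (trans (sym zy) (trans (cong (_*ᵥ y) z≡0) (*ᵥ-0ˡ y)))
            w , i , w≢0 , ns = shiftable x≢0 z∈C zx z≢0
            h = pair x w i
        in h *ᵥ x , trans (cong (_*ᵥ y) (proj₁ (pair-shift x≢0 z∈C zx z≢0
             (Pair.t∈C x≢0 w≢0 i) (Pair.t-nonsingular x≢0 w≢0 i) ns))) zy
      surjective : ∀ u → ∃[ v ] pairSum x v *ᵥ y ≡ u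
      surjective u = hit u (u ≟ᵥ 0ᵥ)

  -- The pairs of `h` and `k` at `x` both sum to `z`. By `pairSum-injective` they are the same pair.
  shift-unique : ∀ {x z h k} → x ≢ 0ᵥ → z ∈ C → z *ᵥ x ≡ 0ᵥ → z ≢ 0ₘ →
    h ∈ C → Nonsingular h → Nonsingular (h +ₘ z) → k ∈ C → Nonsingular k → Nonsingular (k +ₘ z) →
    k ≡ h ⊎ k ≡ h +ₘ z
  shift-unique x≢0 z∈C zx z≢0 h∈C h-ns hz-ns k∈C k-ns kz-ns =
    proj₂ h-shift k∈C k-ns (pairSum-injective x≢0 (trans (proj₁ k-shift) (sym (proj₁ h-shift))))
    where
    h-shift = pair-shift x≢0 z∈C zx z≢0 h∈C h-ns hz-ns
    k-shift = pair-shift x≢0 z∈C zx z≢0 k∈C k-ns kz-ns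

  -- Cliques of nonsingular elements

  Regular : M n → Set
  Regular A = A ≡ 0ₘ ⊎ Nonsingular A

  regular? : ∀ A → Regular A ⊎ (A ≢ 0ₘ × ∃[ w ] (w ≢ 0ᵥ × A *ᵥ w ≡ 0ᵥ))
  regular? A = decide (A ≟ₘ 0ₘ) (singular? A)
    where
    decide : Dec (A ≡ 0ₘ) → Nonsingular A ⊎ ∃[ w ] (w ≢ 0ᵥ × A *ᵥ w ≡ 0ᵥ) →
      Regular A ⊎ (A ≢ 0ₘ × ∃[ w ] (w ≢ 0ᵥ × A *ᵥ w ≡ 0ᵥ))
    decide (yes A≡0) _         = inj₁ (inj₁ A≡0)
    decide (no _)    (inj₁ ns) = inj₁ (inj₂ ns)
    decide (no A≢0)  (inj₂ w)  = inj₂ (A≢0 , w)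

  regular-vanishing : ∀ {A x} → Regular A → x ≢ 0ᵥ → A *ᵥ x ≡ 0ᵥ → A ≡ 0ₘ
  regular-vanishing (inj₁ A≡0) _   _  = A≡0
  regular-vanishing (inj₂ ns)  x≢0 Ax = contradiction (ns _ Ax) x≢0

  regular-≢0 : ∀ {A} → Regular A → A ≢ 0ₘ → Nonsingular A
  regular-≢0 (inj₁ A≡0) A≢0 = contradiction A≡0 A≢0
  regular-≢0 (inj₂ ns)  _   = ns

  -- If k + l were singular, then (k , l) and (h + k , h + l) would be two ways of writing it.
  adjacent-trans : ∀ {h k l} → h ∈ C → Nonsingular h → k ∈ C → l ∈ C → Regular k → Regular l →
    Regular (h +ₘ k) → Regular (h +ₘ l) → Regular (k +ₘ l)
  adjacent-trans {h} {k} {l} h∈C h-ns k∈C l∈C k-reg l-reg hk-reg hl-reg = decide (regular? (k +ₘ l))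
    where
    z : M n
    z = k +ₘ l
    l-sum : k +ₘ z ≡ l
    l-sum = 𝕄.cancelˡ k l
    hl-sum : (h +ₘ k) +ₘ z ≡ h +ₘ l
    hl-sum = trans (+ₘ-assoc h k z) (cong (h +ₘ_) l-sum)
    decide : Regular z ⊎ (z ≢ 0ₘ × ∃[ w ] (w ≢ 0ᵥ × z *ᵥ w ≡ 0ᵥ)) → Regular z
    decide (inj₁ regular) = regular
    decide (inj₂ (z≢0 , w , w≢0 , zw)) = coincide
      (shift-unique w≢0 (C-+ k l k∈C l∈C) zw z≢0 k∈C (regular-≢0 k-reg k≢0)
        (subst Nonsingular (sym l-sum) (regular-≢0 l-reg l≢0))
        (C-+ h k h∈C k∈C) (regular-≢0 hk-reg hk≢0)
        (subst Nonsingular (sym hl-sum) (regular-≢0 hl-reg hl≢0)))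
      where
      singular : ¬ Regular z
      singular z-reg = z≢0 (regular-vanishing z-reg w≢0 zw)
      -- If one of the four summands were zero, `z` would equal one of the others, which are
      -- regular.
      k≢0 : k ≢ 0ₘ
      k≢0 refl = singular (subst Regular (sym (+ₘ-identityˡ l)) l-reg)
      l≢0 : l ≢ 0ₘ
      l≢0 refl = singular (subst Regular (sym (𝕄.identityʳ k)) k-reg)
      hk≢0 : h +ₘ k ≢ 0ₘ
      hk≢0 eq = singular (subst (λ t → Regular (t +ₘ l)) (𝕄.∙≡ε⇒≡ eq) hl-reg)
      hl≢0 : h +ₘ l ≢ 0ₘ
      hl≢0 eq = singular (subst Regular (trans (+ₘ-comm h k) (cong (k +ₘ_) (𝕄.∙≡ε⇒≡ eq))) hk-reg)
      h≢0 : h ≢ 0ₘ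
      h≢0 refl = w≢0 (h-ns w (*ᵥ-0ˡ w))
      coincide : h +ₘ k ≡ k ⊎ h +ₘ k ≡ k +ₘ z → Regular z
      -- The first coincidence gives `h = 0`, the second `h = z`, so that `z` is nonsingular after
      -- all.
      coincide (inj₁ eq) = contradiction (𝕄.∙-cancelʳ (trans eq (sym (+ₘ-identityˡ k)))) h≢0
      coincide (inj₂ eq) = inj₂ (subst Nonsingular (𝕄.∙-cancelʳ (trans eq (+ₘ-comm k z))) h-ns)

  -- For nonsingular `h` in `C`, the class of `h` together with `0`.
  Clique : M n → M n → Set
  Clique h k = k ∈ C × Regular k × Regular (h +ₘ k)

  module _ {h} (h∈C : h ∈ C) (h-ns : Nonsingular h) where

    clique-adjacent : ∀ {k l} → Clique h k → Clique h l → Regular (k +ₘ l)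
    clique-adjacent (k∈C , k-reg , hk-reg) (l∈C , l-reg , hl-reg) =
      adjacent-trans h∈C h-ns k∈C l∈C k-reg l-reg hk-reg hl-reg

    -- Transitivity is applied with `k` as the middle element: `k` is adjacent to `h`, and to
    -- `k +ₘ l` because their sum is `l`. The middle element must be nonsingular, so `k = 0` is
    -- treated apart.
    clique-+ : ∀ {k l} → Clique h k → Clique h l → Clique h (k +ₘ l)
    clique-+ {k} {l} K@(k∈C , inj₁ refl , _) L = subst (Clique h) (sym (+ₘ-identityˡ l)) L
    clique-+ {k} {l} K@(k∈C , inj₂ k-ns , hk-reg) L@(l∈C , l-reg , hl-reg) =
      C-+ k l k∈C l∈C , clique-adjacent K L ,
      adjacent-trans k∈C k-ns h∈C (C-+ k l k∈C l∈C) (inj₂ h-ns) (clique-adjacent K L)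
        (subst Regular (+ₘ-comm h k) hk-reg) (subst Regular (sym (𝕄.cancelˡ k l)) l-reg)

    clique-determined : ∀ {k l x} → x ≢ 0ᵥ → Clique h k → Clique h l → k *ᵥ x ≡ l *ᵥ x → k ≡ l
    clique-determined {k} {l} x≢0 K L eq =
      𝕄.∙≡ε⇒≡ (regular-vanishing (clique-adjacent K L) x≢0 (*ᵥ-agree⇒+-kills k l eq))

    -- Evaluation at a fixed vector on a clique

    module _ {x : V} (x≢0 : x ≢ 0ᵥ) where

      private
        -- `w` witnesses that `pair x v i` lies outside the clique of `h`.
        Conflict : V → Bool → V → Set
        Conflict v i w = w ≢ 0ᵥ × h *ᵥ w ≡ pair x v i *ᵥ w × h ≢ pair x v i

        Member : V → Bool → Set
        Member v i = Regular (h +ₘ pair x v i)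

        member? : ∀ v i → Member v i ⊎ ∃[ w ] Conflict v i w
        member? v i = convert (regular? (h +ₘ pair x v i))
          where
          convert : Member v i ⊎ (h +ₘ pair x v i ≢ 0ₘ × ∃[ w ] (w ≢ 0ᵥ × (h +ₘ pair x v i) *ᵥ w ≡ 0ᵥ)) →
            Member v i ⊎ ∃[ w ] Conflict v i w
          convert (inj₁ reg) = inj₁ reg
          convert (inj₂ (≢0 , w , w≢0 , kills)) =
            inj₂ (w , w≢0 , +-kills⇒*ᵥ-agree h (pair x v i) kills , λ eq → ≢0 (𝕄.≡⇒∙≡ε eq))

        conflict-unique : ∀ {u v i j w} → u ≢ 0ᵥ → v ≢ 0ᵥ → Conflict u i w → Conflict v j w →
          pair x u i ≡ pair x v j
        conflict-unique {i = i} {j} u≢0 v≢0 (w≢0 , hu , h≢u) (_ , hv , h≢v) =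
          at-most-two h∈C h-ns (Pair.t∈C x≢0 u≢0 i) (Pair.t-nonsingular x≢0 u≢0 i)
            (Pair.t∈C x≢0 v≢0 j) (Pair.t-nonsingular x≢0 v≢0 j) w≢0 (sym hu) (sym hv) (h≢u ∘ sym) (h≢v ∘ sym)

        conflict-same : ∀ {u v i j w} → u ≢ 0ᵥ → v ≢ 0ᵥ → Conflict u i w → Conflict v j w → u ≡ v
        conflict-same {i = i} {j} u≢0 v≢0 c d = trans (sym (Pair.t-value x≢0 u≢0 i))
          (trans (cong (_*ᵥ x) (conflict-unique u≢0 v≢0 c d)) (Pair.t-value x≢0 v≢0 j))

        not-both : ∀ {v} → v ≢ 0ᵥ → Member v false → Member v true → ⊥
        not-both {v} v≢0 m₀ m₁ = pair-distinct x≢0 v≢0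
          (clique-determined x≢0 (T.t∈C false , inj₂ (T.t-nonsingular false) , m₀)
            (T.t∈C true , inj₂ (T.t-nonsingular true) , m₁) (trans (T.t-value false) (sym (T.t-value true))))
          where module T = Pair x≢0 v≢0

        Mark : V → V → Set
        Mark v w = (v ≡ 0ᵥ × w ≡ 0ᵥ) ⊎ (v ≢ 0ᵥ × ∃[ i ] Conflict v i w)

        mark : ∀ v → ∃[ w ] Mark v w
        mark v = choose (v ≟ᵥ 0ᵥ) (member? v false) (member? v true)
          where
          choose : Dec (v ≡ 0ᵥ) → Member v false ⊎ ∃[ w ] Conflict v false w →
            Member v true ⊎ ∃[ w ] Conflict v true w → ∃[ w ] Mark v w
          choose (yes v≡0) _ _ = 0ᵥ , inj₁ (v≡0 , refl)
          choose (no v≢0) (inj₂ (w , c)) _ = w , inj₂ (v≢0 , false , c)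
          choose (no v≢0) (inj₁ _) (inj₂ (w , c)) = w , inj₂ (v≢0 , true , c)
          choose (no v≢0) (inj₁ m₀) (inj₁ m₁) = ⊥-elim (not-both v≢0 m₀ m₁)

        mark-injective : ∀ {u v w} → Mark u w → Mark v w → u ≡ v
        mark-injective (inj₁ (refl , _)) (inj₁ (refl , _)) = refl
        mark-injective (inj₁ (_ , w≡0)) (inj₂ (_ , _ , w≢0 , _)) = contradiction w≡0 w≢0
        mark-injective (inj₂ (_ , _ , w≢0 , _)) (inj₁ (_ , w≡0)) = contradiction w≡0 w≢0
        mark-injective (inj₂ (u≢0 , _ , c)) (inj₂ (v≢0 , _ , d)) = conflict-same u≢0 v≢0 c d

        unmark : ∀ w → ∃[ v ] proj₁ (mark v) ≡ w
        unmark = injective⇒surjective (λ {u} {v} eq →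
          mark-injective (proj₂ (mark u)) (subst (Mark v) (sym eq) (proj₂ (mark v))))

        -- Marking is onto, so `w` is the mark of some `u`, and `mark-injective` identifies `u` with
        -- `v`. Thus all conflicts of one pair occur at a single vector.
        conflict-mark : ∀ {v i w} → v ≢ 0ᵥ → Conflict v i w → proj₁ (mark v) ≡ w
        conflict-mark {v} {i} {w} v≢0 c@(w≢0 , _) = finish (unmark w)
          where
          finish : ∃[ u ] proj₁ (mark u) ≡ w → proj₁ (mark v) ≡ w
          finish (u , eq) = trans (cong (λ t → proj₁ (mark t))
            (sym (mark-injective (subst (Mark u) eq (proj₂ (mark u))) (inj₂ (v≢0 , i , c))))) eq

      abstract
        -- Every pair contains an element outside the clique, and the elements outside the
        -- clique correspond to the w ≠ 0 at which they agree with h: there are too few of them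
        -- for a pair to contain two.
        pair-meets-clique : ∀ {v} → v ≢ 0ᵥ → ∃[ i ] Member v i
        pair-meets-clique {v} v≢0 = choose (member? v false) (member? v true)
          where
          -- Both conflicts sit at the mark of `v`, where only one nonsingular element besides `h`
          -- shares its value; the two members of the pair would coincide.
          clash : ∀ {w w′} → Conflict v false w → Conflict v true w′ → ⊥
          clash c d = pair-distinct x≢0 v≢0 (conflict-unique v≢0 v≢0
            (subst (Conflict v false) (trans (sym (conflict-mark v≢0 c)) (conflict-mark v≢0 d)) c) d)
          choose : Member v false ⊎ ∃[ w ] Conflict v false w →
            Member v true ⊎ ∃[ w ] Conflict v true w → ∃[ i ] Member v i
          choose (inj₁ m) _ = false , m
          choose (inj₂ _) (inj₁ m) = true , m
          choose (inj₂ (_ , c)) (inj₂ (_ , d)) = ⊥-elim (clash c d)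

        clique-at : ∀ v → ∃[ k ] (Clique h k × k *ᵥ x ≡ v)
        clique-at v = choose (v ≟ᵥ 0ᵥ)
          where
          choose : Dec (v ≡ 0ᵥ) → ∃[ k ] (Clique h k × k *ᵥ x ≡ v)
          choose (yes refl) = 0ₘ ,
            (subst C (+ᵣ-self h) (C-+ h h h∈C h∈C) , inj₁ refl , inj₂ (subst Nonsingular (sym (𝕄.identityʳ h)) h-ns)) , *ᵥ-0ˡ x
          choose (no v≢0) =
            let i , m = pair-meets-clique v≢0
            in pair x v i , (Pair.t∈C x≢0 v≢0 i , inj₂ (Pair.t-nonsingular x≢0 v≢0 i) , m) , Pair.t-value x≢0 v≢0 i

      private
        K : V → M n
        K v = proj₁ (clique-at v)

      clique-at-+ : ∀ u v → K (u +ᵥ v) ≡ K u +ₘ K v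
      clique-at-+ u v = clique-determined x≢0 (proj₁ (proj₂ (clique-at (u +ᵥ v))))
        (clique-+ (proj₁ (proj₂ (clique-at u))) (proj₁ (proj₂ (clique-at v))))
        (trans (proj₂ (proj₂ (clique-at (u +ᵥ v)))) (sym (trans (*ᵥ-+ˡ (K u) (K v) x)
          (cong₂ _+ᵥ_ (proj₂ (proj₂ (clique-at u))) (proj₂ (proj₂ (clique-at v)))))))

      clique-at-injective : Injective _≡_ _≡_ K
      clique-at-injective {u} {v} eq =
        trans (sym (proj₂ (proj₂ (clique-at u)))) (trans (cong (_*ᵥ x) eq) (proj₂ (proj₂ (clique-at v))))

      clique-at-0 : K 0ᵥ ≡ 0ₘ
      clique-at-0 = 𝕄.idempotent⇒ε (trans (cong K (sym (+ᵥ-self 0ᵥ))) (clique-at-+ 0ᵥ 0ᵥ))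

      clique-at-nonsingular : ∀ {v} → v ≢ 0ᵥ → Nonsingular (K v)
      clique-at-nonsingular {v} v≢0 = regular-≢0 (proj₁ (proj₂ (proj₁ (proj₂ (clique-at v)))))
        (λ Kv≡0 → v≢0 (clique-at-injective (trans Kv≡0 (sym clique-at-0))))

      clique-presemifield : IsPresemifield (λ a y → K a *ᵥ y)
      clique-presemifield = record
        { distrib = (λ a → *ᵥ-+ʳ (K a)) ,
                    (λ y a b → trans (cong (_*ᵥ y) (clique-at-+ a b)) (*ᵥ-+ˡ (K a) (K b) y))
        ; noZeroDivisors = λ a y eq → divide a y eq (a ≟ᵥ 0ᵥ) }
        where
        divide : ∀ a y → K a *ᵥ y ≡ 0ᵥ → Dec (a ≡ 0ᵥ) → a ≡ 0ᵥ ⊎ y ≡ 0ᵥ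
        divide a y eq (yes a≡0) = inj₁ a≡0
        divide a y eq (no a≢0)  = inj₂ (clique-at-nonsingular a≢0 y eq)

  -- Decomposition of the code into two cliques

  module _ {x : V} (x≢0 : x ≢ 0ᵥ) where

    private
      module T = Pair x≢0 x≢0
      y : V
      y = proj₁ (other x)
      y≢0 : y ≢ 0ᵥ
      y≢0 = proj₁ (proj₂ (other x))
      x≢y : x ≢ y
      x≢y = proj₂ (proj₂ (other x))

    -- The generators are the two nonsingular elements fixing `x`. They are distinct but agree at
    -- `x`, so they cannot be adjacent. Elements are indexed by their value at `x`.
    K : Bool → V → M n
    K i v = proj₁ (clique-at (T.t∈C i) (T.t-nonsingular i) x≢0 v)

    K-clique : ∀ i v → Clique (pair x x i) (K i v)
    K-clique i v = proj₁ (proj₂ (clique-at (T.t∈C i) (T.t-nonsingular i) x≢0 v))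

    K∈C : ∀ i v → K i v ∈ C
    K∈C i v = proj₁ (K-clique i v)

    K-value : ∀ i v → K i v *ᵥ x ≡ v
    K-value i v = proj₂ (proj₂ (clique-at (T.t∈C i) (T.t-nonsingular i) x≢0 v))

    K-+ : ∀ i u v → K i (u +ᵥ v) ≡ K i u +ₘ K i v
    K-+ i = clique-at-+ (T.t∈C i) (T.t-nonsingular i) x≢0

    K-injective : ∀ i → Injective _≡_ _≡_ (K i)
    K-injective i = clique-at-injective (T.t∈C i) (T.t-nonsingular i) x≢0

    K-0 : ∀ i → K i 0ᵥ ≡ 0ₘ
    K-0 i = clique-at-0 (T.t∈C i) (T.t-nonsingular i) x≢0

    K-nonsingular : ∀ i {v} → v ≢ 0ᵥ → Nonsingular (K i v)
    K-nonsingular i = clique-at-nonsingular (T.t∈C i) (T.t-nonsingular i) x≢0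

    K-presemifield : ∀ i → IsPresemifield (λ a y → K i a *ᵥ y)
    K-presemifield i = clique-presemifield (T.t∈C i) (T.t-nonsingular i) x≢0

    -- A common nonzero element is adjacent to both generators, which `adjacent-trans` then makes
    -- adjacent to each other. An element in both cliques has the same index `v` in each, namely its
    -- value at `x`.
    cliques-disjoint : ∀ {v} → K false v ≡ K true v → v ≡ 0ᵥ
    cliques-disjoint {v} eq = decide (v ≟ᵥ 0ᵥ)
      where
      k = K false v
      decide : Dec (v ≡ 0ᵥ) → v ≡ 0ᵥ
      decide (yes v≡0) = v≡0
      decide (no v≢0) = contradiction
        (𝕄.∙≡ε⇒≡ (regular-vanishing generators-adjacent x≢0
          (*ᵥ-agree⇒+-kills _ _ (trans (T.t-value false) (sym (T.t-value true))))))
        (pair-distinct x≢0 x≢0)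
        where
        adjacent-to : ∀ i → K i v ≡ k → Regular (k +ₘ pair x x i)
        adjacent-to i Ki≡k = subst Regular (trans (+ₘ-comm _ _) (cong (_+ₘ pair x x i) Ki≡k))
          (proj₂ (proj₂ (K-clique i v)))
        generators-adjacent : Regular (pair x x false +ₘ pair x x true)
        generators-adjacent = adjacent-trans (K∈C false v) (K-nonsingular false v≢0) (T.t∈C false) (T.t∈C true)
          (inj₂ (T.t-nonsingular false)) (inj₂ (T.t-nonsingular true))
          (adjacent-to false refl) (adjacent-to true (sym eq))

    cliques-sum : ∀ {A} → A ∈ C → ∃[ a ] ∃[ b ] A ≡ K false a +ₘ K true b
    -- The target is what the equation at `y` leaves for `difference a` once `b` is eliminated.
    cliques-sum {A} A∈C = solve (injective⇒surjective difference-injective (A *ᵥ y +ᵥ K true (A *ᵥ x) *ᵥ y))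
      where
      difference : V → V
      difference a = K false a *ᵥ y +ᵥ K true a *ᵥ y
      difference-injective : Injective _≡_ _≡_ difference
      -- By additivity it suffices to look at `a +ᵥ b`: the elements of the two cliques with this
      -- index agree at `x` by construction and at `y` by `eq`, so they are equal.
      difference-injective {a} {b} eq = 𝕍.∙≡ε⇒≡ (cliques-disjoint
        (determined (K∈C false (a +ᵥ b)) (K∈C true (a +ᵥ b)) x≢0 y≢0 x≢y
          (trans (K-value false (a +ᵥ b)) (sym (K-value true (a +ᵥ b))))
          (𝕍.∙≡ε⇒≡ (begin
            K false (a +ᵥ b) *ᵥ y +ᵥ K true (a +ᵥ b) *ᵥ y
              ≡⟨ cong₂ _+ᵥ_ (split false) (split true) ⟩
            (K false a *ᵥ y +ᵥ K false b *ᵥ y) +ᵥ (K true a *ᵥ y +ᵥ K true b *ᵥ y)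
              ≡⟨ 𝕍.interchange _ _ _ _ ⟩
            difference a +ᵥ difference b
              ≡⟨ 𝕍.≡⇒∙≡ε eq ⟩
            0ᵥ ∎))))
        where
        open ≡-Reasoning
        split : ∀ i → K i (a +ᵥ b) *ᵥ y ≡ K i a *ᵥ y +ᵥ K i b *ᵥ y
        split i = trans (cong (_*ᵥ y) (K-+ i a b)) (*ᵥ-+ˡ (K i a) (K i b) y)
      -- Comparing values at x forces b = a + A x.
      solve : ∃[ a ] difference a ≡ A *ᵥ y +ᵥ K true (A *ᵥ x) *ᵥ y → ∃[ a ] ∃[ b ] A ≡ K false a +ₘ K true b
      solve (a , eq) = a , a +ᵥ A *ᵥ x ,
        determined A∈C (C-+ _ _ (K∈C false a) (K∈C true (a +ᵥ A *ᵥ x))) x≢0 y≢0 x≢y (sym at-x) (sym at-y)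
        where
        open ≡-Reasoning
        at-x : (K false a +ₘ K true (a +ᵥ A *ᵥ x)) *ᵥ x ≡ A *ᵥ x
        at-x = begin
          (K false a +ₘ K true (a +ᵥ A *ᵥ x)) *ᵥ x      ≡⟨ *ᵥ-+ˡ _ _ x ⟩
          K false a *ᵥ x +ᵥ K true (a +ᵥ A *ᵥ x) *ᵥ x   ≡⟨ cong₂ _+ᵥ_ (K-value false a) (K-value true _) ⟩
          a +ᵥ (a +ᵥ A *ᵥ x)                            ≡⟨ 𝕍.cancelˡ a (A *ᵥ x) ⟩
          A *ᵥ x                                        ∎
        at-y : (K false a +ₘ K true (a +ᵥ A *ᵥ x)) *ᵥ y ≡ A *ᵥ y
        at-y = begin
          (K false a +ₘ K true (a +ᵥ A *ᵥ x)) *ᵥ y                       ≡⟨ *ᵥ-+ˡ _ _ y ⟩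
          K false a *ᵥ y +ᵥ K true (a +ᵥ A *ᵥ x) *ᵥ y                    ≡⟨ cong (λ B → K false a *ᵥ y +ᵥ B *ᵥ y) (K-+ true a (A *ᵥ x)) ⟩
          K false a *ᵥ y +ᵥ (K true a +ₘ K true (A *ᵥ x)) *ᵥ y           ≡⟨ cong (K false a *ᵥ y +ᵥ_) (*ᵥ-+ˡ _ _ y) ⟩
          K false a *ᵥ y +ᵥ (K true a *ᵥ y +ᵥ K true (A *ᵥ x) *ᵥ y)      ≡⟨ sym (+ᵥ-assoc _ _ _) ⟩
          difference a +ᵥ K true (A *ᵥ x) *ᵥ y                           ≡⟨ cong (_+ᵥ K true (A *ᵥ x) *ᵥ y) (trans eq (+ᵥ-comm _ _)) ⟩
          (K true (A *ᵥ x) *ᵥ y +ᵥ A *ᵥ y) +ᵥ K true (A *ᵥ x) *ᵥ y       ≡⟨ +ᵥ-comm _ _ ⟩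
          K true (A *ᵥ x) *ᵥ y +ᵥ (K true (A *ᵥ x) *ᵥ y +ᵥ A *ᵥ y)       ≡⟨ 𝕍.cancelˡ _ _ ⟩
          A *ᵥ y                                                         ∎

    maps-are-differences : Maps C ≐ DifferenceMaps (λ a y → K false a *ᵥ y) (λ b y → K true b *ᵥ y)
    -- Negation in 𝔽₂ is the identity function, so `-ᵥ` and `+ᵥ` agree by computation.
    maps-are-differences =
      (λ {f} (A , A∈C , Af) → let a , b , eq = cliques-sum A∈C in
        a , b , λ z → trans (sym (Af z)) (trans (cong (_*ᵥ z) eq) (*ᵥ-+ˡ (K false a) (K true b) z))) ,
      (λ {f} (a , b , fz) → K false a +ₘ K true b , C-+ _ _ (K∈C false a) (K∈C true b) ,
        λ z → trans (*ᵥ-+ˡ (K false a) (K true b) z) (sym (fz z)))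

    SpreadSet : Pred (M n) 0ℓ
    SpreadSet A = ∃[ a ] K false a ≡ A

    spreadSet⊆C : SpreadSet ⊆ C
    spreadSet⊆C (a , refl) = K∈C false a

    spreadSet-+ : AdditivelyClosed SpreadSet
    spreadSet-+ _ _ (a , refl) (b , refl) = a +ᵥ b , K-+ false a b

    spreadSet-card : HasCardinality SpreadSet (2 ^ n)
    spreadSet-card = K false ∘ decode n , decode-injective n ∘ K-injective false , λ A → mk⇔
      (λ (a , eq) → encode a , trans (cong (K false) (decode-encode a)) eq)
      (λ (i , eq) → decode n i , eq)

    spreadSet-invertible : ∀ A → A ∈ SpreadSet → A ≢ 0ₘ → Invertible A
    spreadSet-invertible _ (a , refl) Ka≢0 = nonsingular⇒invertible
      (K-nonsingular false (λ a≡0 → Ka≢0 (trans (cong (K false) a≡0) (K-0 false))))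

-- Makes the case n = 1 vacuous: four matrices cannot be distinguished by a single bit.
¬card-M₁ : ∀ {C : Pred (M 1) 0ℓ} → ¬ HasCardinality C (2 ^ (2 * 1))
¬card-M₁ (f , f-injective , _) = contradiction
  (injective⇒dim≤ {2} {1} {λ v → head (f (encode v))}
    (λ {u} {v} eq → encode-injective (f-injective (row-injective (f (encode u)) (f (encode v)) eq))))
  1+n≰n
  where
  row-injective : ∀ (A B : M 1) → head A ≡ head B → A ≡ B
  row-injective (_ ∷ []) (_ ∷ []) refl = refl

another : ∀ {m} (x : F₂^ (suc (suc m))) → ∃[ y ] (y ≢ 0ᵥ × x ≢ y)
another (_     ∷ false ∷ _) = false ∷ true ∷ 0ᵥ , (λ ()) , (λ ())
another (false ∷ true  ∷ _) = true ∷ true ∷ 0ᵥ , (λ ()) , (λ ())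
another (true  ∷ true  ∷ _) = false ∷ true ∷ 0ᵥ , (λ ()) , (λ ())

mainTheorem1 : (n : ℕ) → 1 ≤ n →
    (C : Pred (M n) 0ℓ) →
    AdditivelyClosed C →
    HasCardinality C (2 ^ (2 * n)) →
    (∀ A → A ∈ C → A ≢ 0ₘ → rank[ A ]≥ (n ∸ 1)) →
    (Σ[ _⋆_ ∈ Op₂ (F₂^ n) ] Σ[ _∘_ ∈ Op₂ (F₂^ n) ]
    (IsPresemifield _⋆_ × IsPresemifield _∘_ × Maps C ≐ DifferenceMaps _⋆_ _∘_))
    ×
    (Σ[ C′ ∈ Pred (M n) 0ℓ ]
    (C′ ⊆ C × AdditivelyClosed C′ × HasCardinality C′ (2 ^ n) ×
    (∀ A → A ∈ C′ → A ≢ 0ₘ → Invertible A)))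
mainTheorem1 (suc zero)      _ C C-+ C-card _ = contradiction C-card ¬card-M₁
mainTheorem1 n@(suc (suc m)) _ C C-+ C-card C-rank =
  (_ , _ , K-presemifield x≢0 false , K-presemifield x≢0 true , maps-are-differences x≢0) ,
  (SpreadSet x≢0 , spreadSet⊆C x≢0 , spreadSet-+ x≢0 , spreadSet-card x≢0 , spreadSet-invertible x≢0)
  where
  kernel≤1 : ∀ {A x y} → A ∈ C → x ≢ 0ᵥ → y ≢ 0ᵥ → x ≢ y → A *ᵥ x ≡ 0ᵥ → A *ᵥ y ≡ 0ᵥ → A ≡ 0ₘ
  kernel≤1 {A} A∈C x≢0 y≢0 x≢y Ax Ay with A ≟ₘ 0ₘ
  ... | yes A≡0 = A≡0
  ... | no A≢0  =
    -- Rank at least n - 1 plus a kernel of dimension two would give n + 1 ≤ n.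
    let r , hasRank , n-1≤r = C-rank A A∈C A≢0
    in contradiction (≤-trans (s≤s (s≤s n-1≤r)) (rank+2≤n A hasRank x≢0 y≢0 x≢y Ax Ay)) 1+n≰n
  open Code C C-+ C-card kernel≤1 another
  x≢0 : 1₂ ∷ 0ᵥ ≢ 0ᵥ {n}
  x≢0 ()
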